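{- Let $\mathcal I_\nu\subseteq\mathcal I_{int}$ be a finite set of intervals and let $\psi=x.\varphi$ be a simple non adjacent 1-$\mathsf{TPTL}$ formula whose clock constraints use intervals from $\mathcal I_\nu$. Then one can construct a non adjacent $\mathsf{PnEMTL}$ formula $\phi$ such that for every timed word $\rho$, every $i\in dom(\rho)$ and every value $\nu$ of the clock, $\rho,i,\nu\models\psi$ iff $\rho,i\models\phi$; moreover $|\phi|=O(2^{\mathrm{poly}(|\psi|)})$ and the arity of $\phi$ is $O(|\mathcal I_\nu|^2)$.
   Context: Fix a finite set $\Sigma$ of propositions. A timed word over $\Sigma$ is a finite sequence $\rho=(\sigma_1,\tau_1)\cdots(\sigma_n,\tau_n)$ with $\emptyset\neq\sigma_i\subseteq\Sigma$, $\tau_i\in\mathbb R_{\ge0}$, $\tau_1=0$, $\tau_i\le\tau_j$ for $i\le j$; $dom(\rho)=\{1,\dots,n\}$. $\mathcal I_{int}$ is the set of open, half-open or closed real intervals with endpoints in $\mathbb Z\cup\{ -\infty,\infty\}$. 1-$\mathsf{TPTL}$ (one clock $x$, negation normal form): $\varphi::=a\mid\neg a\mid\top\mid\bot\mid x.\varphi\mid T-x\in I\mid x-T\in I\mid\varphi\wedge\varphi\mid\varphi\vee\varphi\mid\varphi\mathsf{U}\varphi\mid\varphi\mathsf{S}\varphi\mid\mathcal G\varphi\mid\mathcal H\varphi$, $a\in\Sigma$, $I\in\mathcal I_{int}$. Semantics with value $\nu$ of $x$: $\rho,i,\nu\models x.\varphi$ iff $\rho,i,\tau_i\models\varphi$;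 $T-x\in I$ holds iff $\tau_i-\nu\in I$; $x-T\in I$ iff $\nu-\tau_i\in I$; $\varphi_1\mathsf U\varphi_2$ at $i$ iff $\exists j>i$ with $\varphi_2$ at $j$ and $\varphi_1$ at all $i<k<j$; $\mathsf S$ symmetric in the past; $\mathcal G\varphi$ ($\mathcal H\varphi$) iff $\varphi$ at all $j>i$ ($j<i$). $\rho,i\models\varphi$ iff $\rho,i,0\models\varphi$. A formula is simple if it is $x.\varphi$ with $\varphi$ freeze-free. Size $|\psi|$ = number of $\mathsf U,\mathsf S$, Boolean operators and freeze quantifiers. Non adjacency: intervals $I_1,I_2$ are non adjacent iff $\sup(I_1)=\inf(I_2)$ implies $\sup(I_1)=0$. A set of intervals is non adjacent iff every ordered pair of (not necessarily distinct) members is non adjacent. A 1-$\mathsf{TPTL}$ formula is non adjacent iff for each subformula $x.\varphi$, the set of intervals occurring in clock constraints of $\varphi$ not in the scope of a freeze quantifier inside $\varphi$ is non adjacent (and likewise for constraints not in the scope of any freeze quantifier). $\mathsf{PnEMTL}$: formulae $\varphi::=a\mid\varphi\wedge\varphi\mid\neg\varphi\mid\mathcal F^k_{I_1,\dots,I_k}(\mathsf A_1,\dots,\mathsf A_{k+1})(S)\mid\mathcal P^k_{I_1,\dots,I_k}(\mathsf A_1,\dots,\mathsf A_{k+1})(S)$, where $a\in\Sigma$, $k\ge1$, $I_w\in\mathcal I_{int}$, $S$ is a finite set of $\mathsf{PnEMTL}$ formulae and $\mathsf A_w$ are finite automata over $2^S$. With $S_j=\{\theta\in S:\rho,j\models\theta\}$,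 $\mathsf{Seg}^+(\rho,x,y,S)=S_x\cdots S_y$ and $\mathsf{Seg}^-(\rho,y,x,S)=S_yS_{y-1}\cdots S_x$ ($x\le y$): $\rho,i_0\models\mathcal F^k_{I_1..I_k}(\mathsf A_1..\mathsf A_{k+1})(S)$ iff $\exists i_0\le i_1\le\dots\le i_k\le n$ with $\tau_{i_w}-\tau_{i_0}\in I_w$, $\mathsf{Seg}^+(\rho,i_{w-1},i_w,S)\in L(\mathsf A_w)$ ($1\le w\le k$) and $\mathsf{Seg}^+(\rho,i_k,n,S)\in L(\mathsf A_{k+1})$; $\rho,i_0\models\mathcal P^k_{I_1..I_k}(\mathsf A_1..\mathsf A_{k+1})(S)$ iff $\exists i_0\ge i_1\ge\dots\ge i_k\ge1$ with $\tau_{i_0}-\tau_{i_w}\in I_w$, $\mathsf{Seg}^-(\rho,i_{w-1},i_w,S)\in L(\mathsf A_w)$ and $\mathsf{Seg}^-(\rho,i_k,1,S)\in L(\mathsf A_{k+1})$. The arity of a formula is the maximal $k$ of its modalities. It is non adjacent iff in every modality $\{I_1,\dots,I_k\}$ is non adjacent. Size: Boolean operators and propositions count 1; $|\mathcal F^k_{\dots}(\mathsf A_1,\dots,\mathsf A_{k+1})(S)|=\sum_{\theta\in S}|\theta|+\sum_w|\mathsf A_w|$ (same for $\mathcal P$).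
   Formalization: Non-adjacency reads x−T∈I as T−x∈−I (literally, T−x∈[2,3] ∧ x−T∈[−2,−1] would be a non-adjacent punctual constraint); |ψ| also counts G and H (otherwise x.Gⁿ⊥ has size 1 for all n); the arity bound is O(max(|I_ν|²,1)). -}

module Defs where

open import Algebra.Bundles using (CommutativeRing)
import Algebra.Properties.Monoid.Mult as Mult
open import Data.Empty using (⊥)
open import Data.Fin using (Fin; zero; suc; toℕ; fromℕ; inject₁)
import Data.Fin as Fin
open import Data.Fin.Subset using (Subset; Nonempty)
import Data.Fin.Subset as Subset
open import Data.Integer using (ℤ; +_; -[1+_]; 0ℤ)
import Data.Integer as ℤ
import Data.Integer.Properties as ℤₚ
open import Data.List using (List; []; _∷_; _++_; length; allFin; filter; reverse)
import Data.List as List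
open import Data.List.Membership.Propositional using (_∈_)
open import Data.List.Relation.Binary.Pointwise using (Pointwise)
open import Data.List.Relation.Unary.All using (All)
open import Data.Nat using (ℕ; zero; suc; NonZero; _+_; _*_; _⊔_; _≤?_; pred)
open import Data.Product using (∃-syntax; Σ-syntax; _×_; _,_)
open import Data.Sum using (_⊎_)
open import Data.Unit using (⊤; tt)
open import Data.Vec.Functional using (Vector; foldr)
open import Function.Bundles using (_⇔_)
open import Level using (0ℓ) renaming (suc to lsuc)
open import Relation.Binary.Core using (Rel)
open import Relation.Binary.PropositionalEquality using (_≡_)
open import Relation.Binary.Structures using (IsStrictTotalOrder)
open import Relation.Nullary using (¬_)
open import Relation.Nullary.Construct.Add.Extrema using (_±; ⊥±; ⊤±; [_])
open import Relation.Nullary.Decidable using (_×-dec_)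
open import Relation.Unary using (Pred; Satisfiable)

-- ℝ by its classical characterisation as the complete ordered field, unique
-- up to isomorphism.  The order is classical: trichotomy is part of
-- IsStrictTotalOrder, and suprema exist for arbitrary predicates.
record RealNumbers : Set (lsuc 0ℓ) where
  infix 4 _<_ _≤_

  field
    commutativeRing : CommutativeRing 0ℓ 0ℓ

  open CommutativeRing commutativeRing public
    using (Carrier; _≈_; 0#; 1#; _-_; -_)
    renaming (_+_ to _+ᴿ_; _*_ to _*ᴿ_)

  field
    _<_                : Rel Carrier 0ℓ
    isStrictTotalOrder : IsStrictTotalOrder _≈_ _<_
    0<1                : 0# < 1#
    +-monoˡ-<          : ∀ {x y} z → x < y → (x +ᴿ z) < (y +ᴿ z)
    *-pos              : ∀ {x y} → 0# < x → 0# < y → 0# < (x *ᴿ y)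
    inverse            : ∀ {x} → ¬ (x ≈ 0#) → ∃[ y ] (x *ᴿ y) ≈ 1#

  _≤_ : Rel Carrier 0ℓ
  x ≤ y = x < y ⊎ x ≈ y

  UpperBound : Pred Carrier 0ℓ → Pred Carrier 0ℓ
  UpperBound P u = ∀ {x} → P x → x ≤ u

  field
    supremum : (P : Pred Carrier 0ℓ) → Satisfiable P → Satisfiable (UpperBound P) →
               ∃[ s ] UpperBound P s × (∀ {u} → UpperBound P u → s ≤ u)

  open Mult (CommutativeRing.+-monoid commutativeRing) using () renaming (_×_ to _·_)

  fromℤ : ℤ → Carrier
  fromℤ (+ n)    = n · 1#
  fromℤ -[1+ n ] = - (suc n · 1#)

------------------------------------------------------------------------
-- Intervals

data Bound : Set where
  infinite : Bound
  excl     : ℤ → Bound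
  incl     : ℤ → Bound

Inhabited : Bound → Bound → Set
Inhabited infinite _        = ⊤
Inhabited (excl _) infinite = ⊤
Inhabited (excl l) (excl u) = l ℤ.< u
Inhabited (excl l) (incl u) = l ℤ.< u
Inhabited (incl _) infinite = ⊤
Inhabited (incl l) (excl u) = l ℤ.< u
Inhabited (incl l) (incl u) = l ℤ.≤ u

-- Intervals are nonempty, so that the endpoints are the infimum and the
-- supremum and distinct terms denote distinct sets of reals.
record Interval : Set where
  constructor ⟨_,_⟩
  field
    lower upper : Bound
    .{inhabited} : Inhabited lower upper

open Interval public

inf : Interval → ℤ ±
inf I with lower I
... | infinite = ⊥±
... | excl l   = [ l ]
... | incl l   = [ l ]

sup : Interval → ℤ ±
sup I with upper I
... | infinite = ⊤±
... | excl u   = [ u ]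
... | incl u   = [ u ]

NonAdjacent : Interval → Interval → Set
NonAdjacent I J = sup I ≡ inf J → sup I ≡ [ 0ℤ ]

NonAdjacentSet : List Interval → Set
NonAdjacentSet 𝓘 = ∀ {I J} → I ∈ 𝓘 → J ∈ 𝓘 → NonAdjacent I J

negBound : Bound → Bound
negBound infinite = infinite
negBound (excl z) = excl (ℤ.- z)
negBound (incl z) = incl (ℤ.- z)

negBound-inhabited : ∀ l u → Inhabited l u → Inhabited (negBound u) (negBound l)
negBound-inhabited infinite infinite _   = tt
negBound-inhabited infinite (excl _) _   = tt
negBound-inhabited infinite (incl _) _   = tt
negBound-inhabited (excl _) infinite _   = tt
negBound-inhabited (excl _) (excl _) l<u = ℤₚ.neg-mono-< l<u
negBound-inhabited (excl _) (incl _) l<u = ℤₚ.neg-mono-< l<u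
negBound-inhabited (incl _) infinite _   = tt
negBound-inhabited (incl _) (excl _) l<u = ℤₚ.neg-mono-< l<u
negBound-inhabited (incl _) (incl _) l≤u = ℤₚ.neg-mono-≤ l≤u

-- { - r ∣ r ∈ I }
neg : Interval → Interval
neg (⟨_,_⟩ l u {p}) = ⟨_,_⟩ (negBound u) (negBound l) {negBound-inhabited l u p}

module _ (ℝ : RealNumbers) where
  open RealNumbers ℝ

  AboveLower : Bound → Carrier → Set
  AboveLower infinite r = ⊤
  AboveLower (excl l) r = fromℤ l < r
  AboveLower (incl l) r = fromℤ l ≤ r

  BelowUpper : Bound → Carrier → Set
  BelowUpper infinite r = ⊤
  BelowUpper (excl u) r = r < fromℤ u
  BelowUpper (incl u) r = r ≤ fromℤ u

  InInterval : Carrier → Interval → Set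
  InInterval r I = AboveLower (lower I) r × BelowUpper (upper I) r

------------------------------------------------------------------------
-- Timed words over the propositions Fin p; positions are counted from 0

record TimedWord (ℝ : RealNumbers) (p : ℕ) : Set where
  open RealNumbers ℝ
  field
    len        : ℕ
    σ          : Fin len → Subset p
    τ          : Fin len → Carrier
    σ-nonempty : ∀ i → Nonempty (σ i)
    τ-nonneg   : ∀ i → 0# ≤ τ i
    τ-start    : ∀ i → toℕ i ≡ 0 → τ i ≈ 0#
    τ-mono     : ∀ {i j} → i Fin.≤ j → τ i ≤ τ j

------------------------------------------------------------------------
-- 1-TPTL

data ClockConstraint : Set where
  T-x∈_ : Interval → ClockConstraint
  x-T∈_ : Interval → ClockConstraint

infixr 6 _∧ᵗ_
infixr 5 _∨ᵗ_
infixr 7 _𝖴_ _𝖲_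
infix  8 x∙_

data TPTL (p : ℕ) : Set where
  atom natom : Fin p → TPTL p
  ⊤ᵗ ⊥ᵗ      : TPTL p
  x∙_        : TPTL p → TPTL p
  clock      : ClockConstraint → TPTL p
  _∧ᵗ_ _∨ᵗ_  : TPTL p → TPTL p → TPTL p
  _𝖴_ _𝖲_    : TPTL p → TPTL p → TPTL p
  𝓖 𝓗        : TPTL p → TPTL p

module _ {ℝ : RealNumbers} {p : ℕ} (ρ : TimedWord ℝ p) where
  open RealNumbers ℝ using (Carrier; _-_)
  open TimedWord ρ

  infix 4 _∣_⊨ᵗ_

  _∣_⊨ᵗ_ : Fin len → Carrier → TPTL p → Set
  i ∣ ν ⊨ᵗ atom a          = a Subset.∈ σ i
  i ∣ ν ⊨ᵗ natom a         = ¬ (a Subset.∈ σ i)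
  i ∣ ν ⊨ᵗ ⊤ᵗ              = ⊤
  i ∣ ν ⊨ᵗ ⊥ᵗ              = ⊥
  i ∣ ν ⊨ᵗ (x∙ φ)          = i ∣ τ i ⊨ᵗ φ
  i ∣ ν ⊨ᵗ clock (T-x∈ I)  = InInterval ℝ (τ i - ν) I
  i ∣ ν ⊨ᵗ clock (x-T∈ I)  = InInterval ℝ (ν - τ i) I
  i ∣ ν ⊨ᵗ (φ ∧ᵗ χ)        = (i ∣ ν ⊨ᵗ φ) × (i ∣ ν ⊨ᵗ χ)
  i ∣ ν ⊨ᵗ (φ ∨ᵗ χ)        = (i ∣ ν ⊨ᵗ φ) ⊎ (i ∣ ν ⊨ᵗ χ)
  i ∣ ν ⊨ᵗ (φ 𝖴 χ)         = ∃[ j ] i Fin.< j × (j ∣ ν ⊨ᵗ χ) ×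
                             (∀ k → i Fin.< k → k Fin.< j → k ∣ ν ⊨ᵗ φ)
  i ∣ ν ⊨ᵗ (φ 𝖲 χ)         = ∃[ j ] j Fin.< i × (j ∣ ν ⊨ᵗ χ) ×
                             (∀ k → j Fin.< k → k Fin.< i → k ∣ ν ⊨ᵗ φ)
  i ∣ ν ⊨ᵗ 𝓖 φ             = ∀ j → i Fin.< j → j ∣ ν ⊨ᵗ φ
  i ∣ ν ⊨ᵗ 𝓗 φ             = ∀ j → j Fin.< i → j ∣ ν ⊨ᵗ φ

FreezeFree : ∀ {p} → TPTL p → Set
FreezeFree (atom _)  = ⊤
FreezeFree (natom _) = ⊤
FreezeFree ⊤ᵗ        = ⊤
FreezeFree ⊥ᵗ        = ⊤
FreezeFree (x∙ _)    = ⊥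
FreezeFree (clock _) = ⊤
FreezeFree (φ ∧ᵗ χ)  = FreezeFree φ × FreezeFree χ
FreezeFree (φ ∨ᵗ χ)  = FreezeFree φ × FreezeFree χ
FreezeFree (φ 𝖴 χ)   = FreezeFree φ × FreezeFree χ
FreezeFree (φ 𝖲 χ)   = FreezeFree φ × FreezeFree χ
FreezeFree (𝓖 φ)     = FreezeFree φ
FreezeFree (𝓗 φ)     = FreezeFree φ

data Simple {p : ℕ} : TPTL p → Set where
  simple : ∀ {φ} → FreezeFree φ → Simple (x∙ φ)

-- 𝓖 and 𝓗 are the duals ¬(⊤ 𝖴 ¬ φ) and ¬(⊤ 𝖲 ¬ φ) and count like 𝖴 and 𝖲:
-- at no cost, 𝓖 ⋯ 𝓖 ⊥ᵗ would pin down the number of later positions by a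
-- formula of constant size.
sizeᵗ : ∀ {p} → TPTL p → ℕ
sizeᵗ (atom _)  = 0
sizeᵗ (natom _) = 1
sizeᵗ ⊤ᵗ        = 0
sizeᵗ ⊥ᵗ        = 0
sizeᵗ (x∙ φ)    = 1 + sizeᵗ φ
sizeᵗ (clock _) = 0
sizeᵗ (φ ∧ᵗ χ)  = 1 + sizeᵗ φ + sizeᵗ χ
sizeᵗ (φ ∨ᵗ χ)  = 1 + sizeᵗ φ + sizeᵗ χ
sizeᵗ (φ 𝖴 χ)   = 1 + sizeᵗ φ + sizeᵗ χ
sizeᵗ (φ 𝖲 χ)   = 1 + sizeᵗ φ + sizeᵗ χ
sizeᵗ (𝓖 φ)     = 1 + sizeᵗ φ
sizeᵗ (𝓗 φ)     = 1 + sizeᵗ φ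

-- Clock constraints not in the scope of a freeze quantifier.
freeConstraints : ∀ {p} → TPTL p → List ClockConstraint
freeConstraints (atom _)  = []
freeConstraints (natom _) = []
freeConstraints ⊤ᵗ        = []
freeConstraints ⊥ᵗ        = []
freeConstraints (x∙ _)    = []
freeConstraints (clock c) = c ∷ []
freeConstraints (φ ∧ᵗ χ)  = freeConstraints φ ++ freeConstraints χ
freeConstraints (φ ∨ᵗ χ)  = freeConstraints φ ++ freeConstraints χ
freeConstraints (φ 𝖴 χ)   = freeConstraints φ ++ freeConstraints χ
freeConstraints (φ 𝖲 χ)   = freeConstraints φ ++ freeConstraints χ
freeConstraints (𝓖 φ)     = freeConstraints φ
freeConstraints (𝓗 φ)     = freeConstraints φ

-- All φ such that x∙ φ is a subformula.
freezeBodies : ∀ {p} → TPTL p → List (TPTL p)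
freezeBodies (atom _)  = []
freezeBodies (natom _) = []
freezeBodies ⊤ᵗ        = []
freezeBodies ⊥ᵗ        = []
freezeBodies (x∙ φ)    = φ ∷ freezeBodies φ
freezeBodies (clock _) = []
freezeBodies (φ ∧ᵗ χ)  = freezeBodies φ ++ freezeBodies χ
freezeBodies (φ ∨ᵗ χ)  = freezeBodies φ ++ freezeBodies χ
freezeBodies (φ 𝖴 χ)   = freezeBodies φ ++ freezeBodies χ
freezeBodies (φ 𝖲 χ)   = freezeBodies φ ++ freezeBodies χ
freezeBodies (𝓖 φ)     = freezeBodies φ
freezeBodies (𝓗 φ)     = freezeBodies φ

scopes : ∀ {p} → TPTL p → List (TPTL p)
scopes φ = φ ∷ freezeBodies φ

interval : ClockConstraint → Interval
interval (T-x∈ I) = I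
interval (x-T∈ I) = I

UsesIntervals : ∀ {p} → List Interval → TPTL p → Set
UsesIntervals 𝓘 ψ = All (λ φ → All (λ c → interval c ∈ 𝓘) (freeConstraints φ)) (scopes ψ)

-- The interval to which a constraint confines T - x.
differenceInterval : ClockConstraint → Interval
differenceInterval (T-x∈ I) = I
differenceInterval (x-T∈ I) = neg I

-- Adjacency is a relation between constraints on one and the same quantity,
-- so x - T ∈ I is read as T - x ∈ neg I.  Comparing the intervals as written
-- would admit T - x ∈ [2,3] ∧ x - T ∈ [-2,-1], that is, the punctual
-- constraint T - x = 2.  If no interval has a negative endpoint, then
-- non-adjacency of the intervals as written implies the condition below.
NonAdjacentᵗ : ∀ {p} → TPTL p → Set
NonAdjacentᵗ ψ =
  All (λ φ → NonAdjacentSet (List.map differenceInterval (freeConstraints φ))) (scopes ψ)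

------------------------------------------------------------------------
-- Finite automata with alphabet 2^(Fin m)

record NFA (m : ℕ) : Set where
  field
    states      : ℕ
    initial     : Fin states
    final       : Subset states
    transitions : List (Fin states × Subset m × Fin states)

module _ {m : ℕ} (A : NFA m) where
  open NFA A

  AcceptsFrom : Fin states → List (Subset m) → Set
  AcceptsFrom q []      = q Subset.∈ final
  AcceptsFrom q (s ∷ w) = ∃[ q′ ] (q , s , q′) ∈ transitions × AcceptsFrom q′ w

  Accepts : List (Subset m) → Set
  Accepts = AcceptsFrom initial

  sizeᴬ : ℕ
  sizeᴬ = states + length transitions

------------------------------------------------------------------------
-- PnEMTL

infixr 6 _∧ᵖ_
infix  7 ¬ᵖ_

-- The finite set S of a modality is given as a family θ of m formulae.
data PnEMTL (p : ℕ) : Set where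
  atom : Fin p → PnEMTL p
  _∧ᵖ_ : PnEMTL p → PnEMTL p → PnEMTL p
  ¬ᵖ_  : PnEMTL p → PnEMTL p
  𝓕 𝓟  : (k : ℕ) .{{_ : NonZero k}} {m : ℕ} (I : Vector Interval k)
         (A : Vector (NFA m) (suc k)) (θ : Vector (PnEMTL p) m) → PnEMTL p

-- Positions from x to y inclusive, in increasing order.
positions : ∀ {n} → ℕ → ℕ → List (Fin n)
positions {n} x y = filter (λ j → (x ≤? toℕ j) ×-dec (toℕ j ≤? y)) (allFin n)

-- The letter S_j as a subset s of the index set of S, where Sat t j means that
-- the t-th formula holds at position j.
IsLetter : ∀ {m n} → (Fin m → Fin n → Set) → Fin n → Subset m → Set
IsLetter Sat j s = ∀ t → (t Subset.∈ s) ⇔ Sat t j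

-- Seg⁺ Sat x y A: the word S_x ⋯ S_y belongs to L(A); likewise Seg⁻ for
-- S_y ⋯ S_x, with x ≤ y in both.
Seg⁺∈L Seg⁻∈L : ∀ {m n} → (Fin m → Fin n → Set) → ℕ → ℕ → NFA m → Set
Seg⁺∈L Sat x y A = ∃[ w ] Pointwise (IsLetter Sat) (positions x y) w × Accepts A w
Seg⁻∈L Sat x y A = ∃[ w ] Pointwise (IsLetter Sat) (reverse (positions x y)) w × Accepts A w

module _ {ℝ : RealNumbers} {p : ℕ} (ρ : TimedWord ℝ p) where
  open RealNumbers ℝ using (Carrier; _-_)
  open TimedWord ρ

  infix 4 _⊨ᵖ_

  _⊨ᵖ_ : Fin len → PnEMTL p → Set
  i ⊨ᵖ atom a    = a Subset.∈ σ i
  i ⊨ᵖ φ ∧ᵖ χ    = (i ⊨ᵖ φ) × (i ⊨ᵖ χ)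
  i ⊨ᵖ ¬ᵖ φ      = ¬ (i ⊨ᵖ φ)
  i ⊨ᵖ 𝓕 k I A θ =
    Σ[ is ∈ Vector (Fin len) (suc k) ] is zero ≡ i ×
      (∀ (w : Fin k) →
         is (inject₁ w) Fin.≤ is (suc w) ×
         InInterval ℝ (τ (is (suc w)) - τ i) (I w) ×
         Seg⁺∈L (λ t j → j ⊨ᵖ θ t) (toℕ (is (inject₁ w))) (toℕ (is (suc w))) (A (inject₁ w))) ×
      Seg⁺∈L (λ t j → j ⊨ᵖ θ t) (toℕ (is (fromℕ k))) (pred len) (A (fromℕ k))
  i ⊨ᵖ 𝓟 k I A θ =
    Σ[ is ∈ Vector (Fin len) (suc k) ] is zero ≡ i ×
      (∀ (w : Fin k) →
         is (suc w) Fin.≤ is (inject₁ w) ×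
         InInterval ℝ (τ i - τ (is (suc w))) (I w) ×
         Seg⁻∈L (λ t j → j ⊨ᵖ θ t) (toℕ (is (suc w))) (toℕ (is (inject₁ w))) (A (inject₁ w))) ×
      Seg⁻∈L (λ t j → j ⊨ᵖ θ t) 0 (toℕ (is (fromℕ k))) (A (fromℕ k))

NonAdjacentᵖ : ∀ {p} → PnEMTL p → Set
NonAdjacentᵖ (atom _)    = ⊤
NonAdjacentᵖ (φ ∧ᵖ χ)    = NonAdjacentᵖ φ × NonAdjacentᵖ χ
NonAdjacentᵖ (¬ᵖ φ)      = NonAdjacentᵖ φ
NonAdjacentᵖ (𝓕 k I A θ) = (∀ v w → NonAdjacent (I v) (I w)) × (∀ t → NonAdjacentᵖ (θ t))
NonAdjacentᵖ (𝓟 k I A θ) = (∀ v w → NonAdjacent (I v) (I w)) × (∀ t → NonAdjacentᵖ (θ t))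

sum maximum : ∀ {n} → Vector ℕ n → ℕ
sum     = foldr _+_ 0
maximum = foldr _⊔_ 0

arity : ∀ {p} → PnEMTL p → ℕ
arity (atom _)    = 0
arity (φ ∧ᵖ χ)    = arity φ ⊔ arity χ
arity (¬ᵖ φ)      = arity φ
arity (𝓕 k I A θ) = k ⊔ maximum (λ t → arity (θ t))
arity (𝓟 k I A θ) = k ⊔ maximum (λ t → arity (θ t))

sizeᵖ : ∀ {p} → PnEMTL p → ℕ
sizeᵖ (atom _)    = 1
sizeᵖ (φ ∧ᵖ χ)    = 1 + sizeᵖ φ + sizeᵖ χ
sizeᵖ (¬ᵖ φ)      = 1 + sizeᵖ φ
sizeᵖ (𝓕 k I A θ) = sum (λ t → sizeᵖ (θ t)) + sum (λ w → sizeᴬ (A w))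
sizeᵖ (𝓟 k I A θ) = sum (λ t → sizeᵖ (θ t)) + sum (λ w → sizeᴬ (A w))

------------------------------------------------------------------------

-- The polynomial with the given coefficients, constant term first.
evalPoly : List ℕ → ℕ → ℕ
evalPoly P n = List.foldr (λ c acc → c + n * acc) 0 P

{-# OPTIONS --safe #-}

-- Clock constraints occur only positively, so a guess of which of them hold is
-- harmless as soon as it is sound: every guessed constraint holds.  Seen from
-- the position i at which x is frozen, a constraint holds on a contiguous range
-- of positions, and it suffices to assert it at both ends of a range.  Hence
-- x∙ φ holds at i iff there are joints before and after i and a labelling of all
-- positions by types (guesses for the subformulae of φ, linked by local
-- conditions as in the automaton construction for LTL) such that at each joint
-- the constraints of its type hold, and between two joints the types claim only
-- constraints claimed at both.  Two joints per distinct interval and direction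
-- are enough, namely its first and last position.  For fixed types at the joints
-- this is a conjunction of one 𝓕 and one 𝓟, where the interval of a joint is the
-- intersection of the constraints of its type; φ becomes the disjunction over
-- all choices of types.

module Submission where

open import Defs
import Algebra.Properties.AbelianGroup as AbelianGroupProperties
import Algebra.Properties.Monoid.Mult as Mult
open import Algebra.Bundles using (CommutativeRing)
open import Data.Bool using (Bool; true; false; T; if_then_else_)
open import Data.Bool.Properties using (T?; T-≡)
open import Data.Empty using (⊥; ⊥-elim)
open import Data.Fin using (Fin; zero; suc; toℕ; fromℕ; inject₁)
import Data.Fin as Fin
import Data.Fin.Properties as Finₚ
open import Data.Fin.Subset using (Subset; ⁅_⁆)
import Data.Fin.Subset as Subset
import Data.Fin.Subset.Properties as Subsetₚ
open import Data.Integer using (ℤ; -[1+_])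
import Data.Integer as ℤ
import Data.Integer.Properties as ℤₚ
open import Data.List
  using (List; []; _∷_; _∷ʳ_; _++_; map; length; lookup; filter; reverse; tabulate; allFin;
         cartesianProduct; cartesianProductWith)
open import Data.List.Membership.Propositional using (_∈_; find; lose)
open import Data.List.Membership.Propositional.Properties
import Data.List.Membership.DecPropositional as DecMembership
open import Data.List.Properties
  using (filter-accept; filter-reject; filter-none; unfold-reverse; map-++;
         length-map; length-++; length-filter; length-tabulate)
open import Data.List.Relation.Binary.Pointwise using (Pointwise; []; _∷_)
open import Data.List.Relation.Unary.All as All using (All; []; _∷_)
import Data.List.Relation.Unary.All.Properties as Allₚ
open import Data.List.Relation.Unary.Any as Any using (Any; here; there)
import Data.List.Relation.Unary.Any.Properties as Anyₚ
open import Data.List.Relation.Unary.Unique.Propositional using (Unique)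
open import Data.Nat using (ℕ; zero; suc; pred; _+_; _*_; _^_; _⊔_; _≤_; _≤?_; z≤n; s≤s)
import Data.Nat as ℕ
import Data.Nat.Properties as ℕₚ
open import Data.Nat.Tactic.RingSolver using (solve-∀)
open import Data.Product using (∃-syntax; Σ-syntax; _×_; _,_; proj₁; proj₂)
open import Data.Sum using (_⊎_; inj₁; inj₂; [_,_]′)
import Data.Sum as Sum
open import Data.Unit using (⊤; tt)
open import Data.Vec as Vec using (Vec; []; _∷_; head)
open import Data.Vec.Functional using (Vector)
import Data.Vec.Properties as Vecₚ
open import Function using (_∘_; flip; id)
open import Function.Bundles using (_⇔_; mk⇔; Equivalence)
open import Level using (0ℓ)
open import Relation.Binary.Construct.StrictToNonStrict as NonStrict using ()
open import Relation.Binary.Core using (Rel)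
open import Relation.Binary.Definitions
  using (Decidable; DecidableEquality; Reflexive; Total; Transitive)
open import Relation.Binary.PropositionalEquality
  using (_≡_; refl; sym; trans; cong; cong₂; subst; subst₂)
open import Relation.Binary.Structures using (IsEquivalence; IsStrictTotalOrder)
open import Relation.Nullary using (¬_; Dec; yes; no)
open import Relation.Nullary.Construct.Add.Extrema using (_±; ⊥±; ⊤±; [_])
import Relation.Nullary.Construct.Add.Extrema as Extrema±
open import Relation.Nullary.Decidable
  using (_×-dec_; _⊎-dec_; _→-dec_; ¬?; ⌊_⌋; toWitness; fromWitness; decidable-stable; map′)

open Equivalence using (to; from)

-- Reals and intervals

-- The formula is fixed before the word, the position and even the model of the reals are given.
-- Hence intervals are compared through their integer endpoints, and the number of joints is a
-- constant: a constraint that never holds still receives two joints, placed at the current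
-- position. Two further joints are the current position itself, so that its own type is asserted in
-- both directions, and the last position of the side in question.
--
-- Non-adjacency survives because an endpoint of an intersection is an endpoint of one of the
-- intervals, and because negation reverses adjacency and fixes 0. An empty intersection is not an
-- `Interval`; there the modality asserts the whole line, and the automata refuse the type instead.
--
-- That joints are extreme positions matters for completeness; soundness takes whatever joints are
-- accepted and relies on convexity. The exponent of the size bound is quadratic since a guess
-- selects linearly many types, each out of exponentially many. Disjunction is expressed by negation
-- and conjunction, hence recovered only up to double negation, which decidability of `φ` on a
-- finite word removes.

module OrderedField (ℝ : RealNumbers) where
  open RealNumbers ℝ renaming (_≤_ to _≤ᴿ_)
  open CommutativeRing commutativeRing
    using (+-cong; +-assoc; +-identityˡ; +-identityʳ; -‿cong; -‿inverseʳ; +-abelianGroup; +-comm)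
  open AbelianGroupProperties +-abelianGroup using (⁻¹-involutive; ⁻¹-∙-comm; ε⁻¹≈ε)
  open Mult (CommutativeRing.+-monoid commutativeRing) using () renaming (_×_ to _·_)
  open IsStrictTotalOrder isStrictTotalOrder public
    using (isEquivalence; <-resp-≈; <-respʳ-≈; <-respˡ-≈)
    renaming (trans to <-trans; irrefl to <-irrefl; _≟_ to _≈?_; _<?_ to _<?_)
  open IsEquivalence isEquivalence public
    renaming (refl to ≈-refl; sym to ≈-sym; trans to ≈-trans)

  ≤-trans : ∀ {x y z} → x ≤ᴿ y → y ≤ᴿ z → x ≤ᴿ z
  ≤-trans = NonStrict.trans _≈_ _<_ isEquivalence <-resp-≈ <-trans

  <-≤-trans : ∀ {x y z} → x < y → y ≤ᴿ z → x < z
  <-≤-trans = NonStrict.<-≤-trans _≈_ _<_ <-trans <-respʳ-≈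

  ≤-<-trans : ∀ {x y z} → x ≤ᴿ y → y < z → x < z
  ≤-<-trans = NonStrict.≤-<-trans _≈_ _<_ ≈-sym <-trans <-respˡ-≈

  ≤-respʳ-≈ : ∀ {x y z} → y ≈ z → x ≤ᴿ y → x ≤ᴿ z
  ≤-respʳ-≈ = NonStrict.≤-respʳ-≈ _≈_ _<_ ≈-trans <-respʳ-≈

  ≤-respˡ-≈ : ∀ {x y z} → y ≈ z → y ≤ᴿ x → z ≤ᴿ x
  ≤-respˡ-≈ = NonStrict.≤-respˡ-≈ _≈_ _<_ ≈-sym ≈-trans <-respˡ-≈

  _≤ᴿ?_ : ∀ x y → Dec (x ≤ᴿ y)
  _≤ᴿ?_ = NonStrict.decidable _≈_ _<_ _≈?_ _<?_

  <-irreflexive : ∀ {x} → ¬ (x < x)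
  <-irreflexive = <-irrefl ≈-refl

  neg-antimono-< : ∀ {x y} → x < y → - y < - x
  neg-antimono-< {x} {y} x<y =
    <-respˡ-≈ left (<-respʳ-≈ right (+-monoˡ-< (- x +ᴿ - y) x<y))
    where
    left : (x +ᴿ (- x +ᴿ - y)) ≈ - y
    left = ≈-trans (≈-sym (+-assoc x (- x) (- y)))
             (≈-trans (+-cong (-‿inverseʳ x) ≈-refl) (+-identityˡ (- y)))
    right : (y +ᴿ (- x +ᴿ - y)) ≈ - x
    right = ≈-trans (+-cong ≈-refl (+-comm (- x) (- y)))
             (≈-trans (≈-sym (+-assoc y (- y) (- x)))
               (≈-trans (+-cong (-‿inverseʳ y) ≈-refl) (+-identityˡ (- x))))

  neg-antimono-≤ : ∀ {x y} → x ≤ᴿ y → - y ≤ᴿ - x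
  neg-antimono-≤ (inj₁ x<y) = inj₁ (neg-antimono-< x<y)
  neg-antimono-≤ (inj₂ x≈y) = inj₂ (-‿cong (≈-sym x≈y))

  -‿monoˡ-≤ : ∀ {x y} z → x ≤ᴿ y → (x - z) ≤ᴿ (y - z)
  -‿monoˡ-≤ z (inj₁ x<y) = inj₁ (+-monoˡ-< (- z) x<y)
  -‿monoˡ-≤ z (inj₂ x≈y) = inj₂ (+-cong x≈y ≈-refl)

  neg-difference : ∀ x y → (x - y) ≈ - (y - x)
  neg-difference x y =
    ≈-trans (+-comm x (- y))
      (≈-trans (+-cong ≈-refl (≈-sym (⁻¹-involutive x))) (⁻¹-∙-comm y (- x)))

  ·1-suc : ∀ n → (n · 1#) < (suc n · 1#)
  ·1-suc n = <-respˡ-≈ (+-identityˡ _) (+-monoˡ-< (n · 1#) 0<1)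

  -- With `<′` the recursion runs on the gap between `m` and `n`, one successor at a time.
  ·1-mono-< : ∀ {m n} → m ℕ.<′ n → (m · 1#) < (n · 1#)
  ·1-mono-< {m} ℕ.<′-base       = ·1-suc m
  ·1-mono-< (ℕ.≤′-step {n} m<n) = <-trans (·1-mono-< m<n) (·1-suc n)

  0≤·1 : ∀ n → 0# ≤ᴿ (n · 1#)
  0≤·1 zero    = inj₂ ≈-refl
  0≤·1 (suc n) = inj₁ (·1-mono-< {0} {suc n} (ℕₚ.≤⇒≤′ (ℕ.s≤s ℕ.z≤n)))

  fromℤ-mono-< : ∀ {a b} → a ℤ.< b → fromℤ a < fromℤ b
  fromℤ-mono-< (ℤ.-<- {m} {n} n<m) = neg-antimono-< (·1-mono-< {suc n} {suc m} (ℕₚ.≤⇒≤′ (ℕ.s≤s n<m)))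
  fromℤ-mono-< (ℤ.-<+ {m} {n}) =
    <-≤-trans (<-respʳ-≈ ε⁻¹≈ε (neg-antimono-< (·1-mono-< {0} {suc m} (ℕₚ.≤⇒≤′ (ℕ.s≤s ℕ.z≤n)))))
              (0≤·1 n)
  fromℤ-mono-< (ℤ.+<+ {m} {n} m<n) = ·1-mono-< {m} {n} (ℕₚ.≤⇒≤′ m<n)

  fromℤ-mono-≤ : ∀ {a b} → a ℤ.≤ b → fromℤ a ≤ᴿ fromℤ b
  fromℤ-mono-≤ {a} {b} a≤b with a ℤₚ.≟ b
  ... | yes refl = inj₂ ≈-refl
  ... | no a≢b   = inj₁ (fromℤ-mono-< (ℤₚ.≤∧≢⇒< a≤b a≢b))

  -- The way back from the reals to the integers: a real point between two bounds has to yield an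
  -- inequality between their integer endpoints.
  fromℤ-cancel-< : ∀ {a b} → fromℤ a < fromℤ b → a ℤ.< b
  fromℤ-cancel-< {a} {b} p with a ℤₚ.<? b
  ... | yes a<b = a<b
  ... | no a≮b  = ⊥-elim (<-irreflexive (<-≤-trans p (fromℤ-mono-≤ (ℤₚ.≮⇒≥ a≮b))))

  fromℤ-cancel-≤ : ∀ {a b} → fromℤ a ≤ᴿ fromℤ b → a ℤ.≤ b
  fromℤ-cancel-≤ {a} {b} p with a ℤₚ.≤? b
  ... | yes a≤b = a≤b
  ... | no a≰b  = ⊥-elim (<-irreflexive (<-≤-trans (fromℤ-mono-< (ℤₚ.≰⇒> a≰b)) p))

  fromℤ-neg : ∀ z → fromℤ (ℤ.- z) ≈ - fromℤ z
  fromℤ-neg (ℤ.+ zero)    = ≈-sym ε⁻¹≈ε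
  fromℤ-neg (ℤ.+ suc n)   = ≈-refl
  fromℤ-neg -[1+ n ]      = ≈-sym (⁻¹-involutive _)

  aboveLower-upward : ∀ b {r s} → r ≤ᴿ s → AboveLower ℝ b r → AboveLower ℝ b s
  aboveLower-upward infinite _   _ = tt
  aboveLower-upward (excl _) r≤s p = <-≤-trans p r≤s
  aboveLower-upward (incl _) r≤s p = ≤-trans p r≤s

  belowUpper-downward : ∀ b {r s} → r ≤ᴿ s → BelowUpper ℝ b s → BelowUpper ℝ b r
  belowUpper-downward infinite _   _ = tt
  belowUpper-downward (excl _) r≤s p = ≤-<-trans r≤s p
  belowUpper-downward (incl _) r≤s p = ≤-trans r≤s p

  -- As time is monotone along the word, this is what makes the positions satisfying a constraint a
  -- contiguous range.
  inInterval-convex : ∀ I {r s t} → r ≤ᴿ s → s ≤ᴿ t →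
                      InInterval ℝ r I → InInterval ℝ t I → InInterval ℝ s I
  inInterval-convex I r≤s s≤t (p , _) (_ , q) =
    aboveLower-upward (lower I) r≤s p , belowUpper-downward (upper I) s≤t q

  aboveLower? : ∀ b r → Dec (AboveLower ℝ b r)
  aboveLower? infinite r = yes tt
  aboveLower? (excl l) r = fromℤ l <? r
  aboveLower? (incl l) r = fromℤ l ≤ᴿ? r

  belowUpper? : ∀ b r → Dec (BelowUpper ℝ b r)
  belowUpper? infinite r = yes tt
  belowUpper? (excl u) r = r <? fromℤ u
  belowUpper? (incl u) r = r ≤ᴿ? fromℤ u

  inInterval? : ∀ r I → Dec (InInterval ℝ r I)
  inInterval? r I = aboveLower? (lower I) r ×-dec belowUpper? (upper I) r

  belowUpper-neg : ∀ b {r s} → s ≈ - r → AboveLower ℝ b r → BelowUpper ℝ (negBound b) s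
  belowUpper-neg infinite _ _ = tt
  belowUpper-neg (excl z) e p =
    <-respˡ-≈ (≈-sym e) (<-respʳ-≈ (≈-sym (fromℤ-neg z)) (neg-antimono-< p))
  belowUpper-neg (incl z) e p =
    ≤-respˡ-≈ (≈-sym e) (≤-respʳ-≈ (≈-sym (fromℤ-neg z)) (neg-antimono-≤ p))

  aboveLower-neg : ∀ b {r s} → s ≈ - r → BelowUpper ℝ b r → AboveLower ℝ (negBound b) s
  aboveLower-neg infinite _ _ = tt
  aboveLower-neg (excl z) e p =
    <-respʳ-≈ (≈-sym e) (<-respˡ-≈ (≈-sym (fromℤ-neg z)) (neg-antimono-< p))
  aboveLower-neg (incl z) e p =
    ≤-respʳ-≈ (≈-sym e) (≤-respˡ-≈ (≈-sym (fromℤ-neg z)) (neg-antimono-≤ p))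

  inInterval-neg : ∀ I {r s} → s ≈ - r → InInterval ℝ r I → InInterval ℝ s (neg I)
  inInterval-neg I e (p , q) = aboveLower-neg (upper I) e q , belowUpper-neg (lower I) e p

negBound-involutive : ∀ b → negBound (negBound b) ≡ b
negBound-involutive infinite = refl
negBound-involutive (excl z) = cong excl (ℤₚ.neg-involutive z)
negBound-involutive (incl z) = cong incl (ℤₚ.neg-involutive z)

-- The inhabitation proof is irrelevant, so the two bounds determine the interval.
interval-≡ : ∀ {I J} → lower I ≡ lower J → upper I ≡ upper J → I ≡ J
interval-≡ refl refl = refl

neg-involutive : ∀ I → neg (neg I) ≡ I
neg-involutive I = interval-≡ (negBound-involutive (lower I)) (negBound-involutive (upper I))

_≟ᴮ_ : DecidableEquality Bound
infinite ≟ᴮ infinite = yes refl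
infinite ≟ᴮ excl _   = no λ ()
infinite ≟ᴮ incl _   = no λ ()
excl _   ≟ᴮ infinite = no λ ()
excl x   ≟ᴮ excl y   = map′ (cong excl) (λ { refl → refl }) (x ℤₚ.≟ y)
excl _   ≟ᴮ incl _   = no λ ()
incl _   ≟ᴮ infinite = no λ ()
incl _   ≟ᴮ excl _   = no λ ()
incl x   ≟ᴮ incl y   = map′ (cong incl) (λ { refl → refl }) (x ℤₚ.≟ y)

_≟ᴵ_ : DecidableEquality Interval
I ≟ᴵ J = map′ (λ (p , q) → interval-≡ p q) (λ { refl → refl , refl })
              ((lower I ≟ᴮ lower J) ×-dec (upper I ≟ᴮ upper J))

open DecMembership _≟ᴵ_ using () renaming (_∈?_ to _∈ᴵ?_)

inhabited? : ∀ l u → Dec (Inhabited l u)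
inhabited? infinite _        = yes tt
inhabited? (excl _) infinite = yes tt
inhabited? (excl l) (excl u) = l ℤₚ.<? u
inhabited? (excl l) (incl u) = l ℤₚ.<? u
inhabited? (incl _) infinite = yes tt
inhabited? (incl l) (excl u) = l ℤₚ.<? u
inhabited? (incl l) (incl u) = l ℤₚ.≤? u

-- Intersections of intervals

full : Interval
full = ⟨ infinite , infinite ⟩

-- The endpoints are compared as integers, and the implication then holds in every model of the
-- reals; the intersection can thus be formed before a model is given.
lower-total : ∀ a b → (∀ ℝ {r} → AboveLower ℝ a r → AboveLower ℝ b r) ⊎
                      (∀ ℝ {r} → AboveLower ℝ b r → AboveLower ℝ a r)
lower-total _        infinite = inj₁ λ _ _ → tt
lower-total infinite _        = inj₂ λ _ _ → tt
lower-total (excl x) (excl y) with ℤₚ.≤-total x y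
... | inj₁ x≤y = inj₂ λ ℝ p → let open OrderedField ℝ in ≤-<-trans (fromℤ-mono-≤ x≤y) p
... | inj₂ y≤x = inj₁ λ ℝ p → let open OrderedField ℝ in ≤-<-trans (fromℤ-mono-≤ y≤x) p
lower-total (incl x) (incl y) with ℤₚ.≤-total x y
... | inj₁ x≤y = inj₂ λ ℝ p → let open OrderedField ℝ in ≤-trans (fromℤ-mono-≤ x≤y) p
... | inj₂ y≤x = inj₁ λ ℝ p → let open OrderedField ℝ in ≤-trans (fromℤ-mono-≤ y≤x) p
lower-total (excl x) (incl y) with x ℤₚ.<? y
... | yes x<y = inj₂ λ ℝ p → let open OrderedField ℝ in <-≤-trans (fromℤ-mono-< x<y) p
... | no x≮y  = inj₁ λ ℝ p → let open OrderedField ℝ in inj₁ (≤-<-trans (fromℤ-mono-≤ (ℤₚ.≮⇒≥ x≮y)) p)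
lower-total (incl x) (excl y) = Sum.swap (lower-total (excl y) (incl x))

upper-total : ∀ a b → (∀ ℝ {r} → BelowUpper ℝ a r → BelowUpper ℝ b r) ⊎
                      (∀ ℝ {r} → BelowUpper ℝ b r → BelowUpper ℝ a r)
upper-total _        infinite = inj₁ λ _ _ → tt
upper-total infinite _        = inj₂ λ _ _ → tt
upper-total (excl x) (excl y) with ℤₚ.≤-total x y
... | inj₁ x≤y = inj₁ λ ℝ p → let open OrderedField ℝ in <-≤-trans p (fromℤ-mono-≤ x≤y)
... | inj₂ y≤x = inj₂ λ ℝ p → let open OrderedField ℝ in <-≤-trans p (fromℤ-mono-≤ y≤x)
upper-total (incl x) (incl y) with ℤₚ.≤-total x y
... | inj₁ x≤y = inj₁ λ ℝ p → let open OrderedField ℝ in ≤-trans p (fromℤ-mono-≤ x≤y)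
... | inj₂ y≤x = inj₂ λ ℝ p → let open OrderedField ℝ in ≤-trans p (fromℤ-mono-≤ y≤x)
upper-total (excl x) (incl y) with y ℤₚ.<? x
... | yes y<x = inj₂ λ ℝ p → let open OrderedField ℝ in ≤-<-trans p (fromℤ-mono-< y<x)
... | no y≮x  = inj₁ λ ℝ p → let open OrderedField ℝ in inj₁ (<-≤-trans p (fromℤ-mono-≤ (ℤₚ.≮⇒≥ y≮x)))
upper-total (incl x) (excl y) = Sum.swap (upper-total (excl y) (incl x))

-- Each bound of a meet is the bound of a member, so meets of a non-adjacent
-- set of intervals are again non-adjacent.
meetLower meetUpper : List Interval → Bound
meetLower []       = infinite
meetLower (J ∷ Js) with lower-total (lower J) (meetLower Js)
... | inj₁ _ = lower J
... | inj₂ _ = meetLower Js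
meetUpper []       = infinite
meetUpper (J ∷ Js) with upper-total (upper J) (meetUpper Js)
... | inj₁ _ = upper J
... | inj₂ _ = meetUpper Js

meetLower-origin : ∀ Js → meetLower Js ≡ infinite ⊎ (∃[ J ] J ∈ Js × meetLower Js ≡ lower J)
meetLower-origin []       = inj₁ refl
meetLower-origin (J ∷ Js) with lower-total (lower J) (meetLower Js)
... | inj₁ _ = inj₂ (J , here refl , refl)
... | inj₂ _ = Sum.map₂ (λ (K , K∈ , e) → K , there K∈ , e) (meetLower-origin Js)

meetUpper-origin : ∀ Js → meetUpper Js ≡ infinite ⊎ (∃[ J ] J ∈ Js × meetUpper Js ≡ upper J)
meetUpper-origin []       = inj₁ refl
meetUpper-origin (J ∷ Js) with upper-total (upper J) (meetUpper Js)
... | inj₁ _ = inj₂ (J , here refl , refl)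
... | inj₂ _ = Sum.map₂ (λ (K , K∈ , e) → K , there K∈ , e) (meetUpper-origin Js)

Consistent : List Interval → Set
Consistent Js = Inhabited (meetLower Js) (meetUpper Js)

consistent? : ∀ Js → Dec (Consistent Js)
consistent? Js = inhabited? (meetLower Js) (meetUpper Js)

-- Junk value: the meet of an inconsistent list is the full line.
meet : List Interval → Interval
meet Js with consistent? Js
... | yes c = ⟨_,_⟩ (meetLower Js) (meetUpper Js) {c}
... | no _  = full

-- `sup` and `inf` inspect the bound of an interval by `with`. As functions of the bound alone they
-- can be rewritten along equations between bounds.
supᴮ infᴮ : Bound → ℤ ±
supᴮ infinite = ⊤±
supᴮ (excl u) = [ u ]
supᴮ (incl u) = [ u ]
infᴮ infinite = ⊥±
infᴮ (excl l) = [ l ]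
infᴮ (incl l) = [ l ]

sup-bound : ∀ I → sup I ≡ supᴮ (upper I)
sup-bound I with upper I
... | infinite = refl
... | excl _   = refl
... | incl _   = refl

inf-bound : ∀ I → inf I ≡ infᴮ (lower I)
inf-bound I with lower I
... | infinite = refl
... | excl _   = refl
... | incl _   = refl

infᴮ≢⊤ : ∀ b → ¬ (⊤± ≡ infᴮ b)
infᴮ≢⊤ infinite ()
infᴮ≢⊤ (excl _) ()
infᴮ≢⊤ (incl _) ()

supᴮ≢⊥ : ∀ b → ¬ (supᴮ b ≡ ⊥±)
supᴮ≢⊥ infinite ()
supᴮ≢⊥ (excl _) ()
supᴮ≢⊥ (incl _) ()

OriginatesIn : List Interval → Interval → Set
OriginatesIn Ks I = (lower I ≡ infinite ⊎ (∃[ J ] J ∈ Ks × lower I ≡ lower J)) ×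
                    (upper I ≡ infinite ⊎ (∃[ J ] J ∈ Ks × upper I ≡ upper J))

meet-originates : ∀ Js → OriginatesIn Js (meet Js)
meet-originates Js with consistent? Js
... | yes _ = meetLower-origin Js , meetUpper-origin Js
... | no _  = inj₁ refl , inj₁ refl

-- If the supremum of `I` is the infimum of `J`, both are finite and hence endpoints of members of
-- `Ks`, to which the hypothesis applies.
nonAdjacent-originates : ∀ {Ks} I J → NonAdjacentSet Ks →
                         OriginatesIn Ks I → OriginatesIn Ks J → NonAdjacent I J
nonAdjacent-originates I J na (_ , u) (l , _) e
  with e′ ← trans (sym (sup-bound I)) (trans e (inf-bound J)) | u | l
... | inj₁ p | _ = ⊥-elim (infᴮ≢⊤ (lower J) (subst (λ b → supᴮ b ≡ infᴮ (lower J)) p e′))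
... | inj₂ _ | inj₁ q = ⊥-elim (supᴮ≢⊥ (upper I) (subst (λ b → supᴮ (upper I) ≡ infᴮ b) q e′))
... | inj₂ (K , K∈ , p) | inj₂ (M , M∈ , q) =
  trans supI≡supK (na K∈ M∈ (trans (sym supI≡supK) (trans e infJ≡infM)))
  where
  supI≡supK : sup I ≡ sup K
  supI≡supK = trans (sup-bound I) (trans (cong supᴮ p) (sym (sup-bound K)))
  infJ≡infM : inf J ≡ inf M
  infJ≡infM = trans (inf-bound J) (trans (cong infᴮ q) (sym (inf-bound M)))

module _ (ℝ : RealNumbers) where
  open OrderedField ℝ

  aboveMeetLower⇒ : ∀ Js {r} → AboveLower ℝ (meetLower Js) r → All (λ J → AboveLower ℝ (lower J) r) Js
  aboveMeetLower⇒ []       _ = []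
  aboveMeetLower⇒ (J ∷ Js) p with lower-total (lower J) (meetLower Js)
  ... | inj₁ h = p ∷ aboveMeetLower⇒ Js (h ℝ p)
  ... | inj₂ h = h ℝ p ∷ aboveMeetLower⇒ Js p

  belowMeetUpper⇒ : ∀ Js {r} → BelowUpper ℝ (meetUpper Js) r → All (λ J → BelowUpper ℝ (upper J) r) Js
  belowMeetUpper⇒ []       _ = []
  belowMeetUpper⇒ (J ∷ Js) p with upper-total (upper J) (meetUpper Js)
  ... | inj₁ h = p ∷ belowMeetUpper⇒ Js (h ℝ p)
  ... | inj₂ h = h ℝ p ∷ belowMeetUpper⇒ Js p

  aboveMeetLower : ∀ Js {r} → All (λ J → InInterval ℝ r J) Js → AboveLower ℝ (meetLower Js) r
  aboveMeetLower []       _ = tt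
  aboveMeetLower (J ∷ Js) (p ∷ ps) with lower-total (lower J) (meetLower Js)
  ... | inj₁ _ = proj₁ p
  ... | inj₂ _ = aboveMeetLower Js ps

  belowMeetUpper : ∀ Js {r} → All (λ J → InInterval ℝ r J) Js → BelowUpper ℝ (meetUpper Js) r
  belowMeetUpper []       _ = tt
  belowMeetUpper (J ∷ Js) (p ∷ ps) with upper-total (upper J) (meetUpper Js)
  ... | inj₁ _ = proj₂ p
  ... | inj₂ _ = belowMeetUpper Js ps

  point⇒inhabited : ∀ l u {r} → AboveLower ℝ l r → BelowUpper ℝ u r → Inhabited l u
  point⇒inhabited infinite _        _ _ = tt
  point⇒inhabited (excl _) infinite _ _ = tt
  point⇒inhabited (excl _) (excl _) p q = fromℤ-cancel-< (<-trans p q)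
  point⇒inhabited (excl _) (incl _) p q = fromℤ-cancel-< (<-≤-trans p q)
  point⇒inhabited (incl _) infinite _ _ = tt
  point⇒inhabited (incl _) (excl _) p q = fromℤ-cancel-< (≤-<-trans p q)
  point⇒inhabited (incl _) (incl _) p q = fromℤ-cancel-≤ (≤-trans p q)

  -- Guarantees that the consistency test in the automata never refuses a type all of whose claims
  -- are true.
  meet-consistent : ∀ Js {r} → All (λ J → InInterval ℝ r J) Js → Consistent Js
  meet-consistent Js ps = point⇒inhabited _ _ (aboveMeetLower Js ps) (belowMeetUpper Js ps)

  ∈meet⁺ : ∀ Js {r} → All (λ J → InInterval ℝ r J) Js → InInterval ℝ r (meet Js)
  ∈meet⁺ Js ps with consistent? Js
  ... | yes _ = aboveMeetLower Js ps , belowMeetUpper Js ps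
  ... | no _  = tt , tt

  ∈meet⁻ : ∀ Js {r} → Consistent Js → InInterval ℝ r (meet Js) → All (λ J → InInterval ℝ r J) Js
  ∈meet⁻ Js c p with consistent? Js
  ... | yes _ = All.zip (aboveMeetLower⇒ Js (proj₁ p) , belowMeetUpper⇒ Js (proj₂ p))
  ... | no ¬c = ⊥-elim (¬c c)

neg-finite : ∀ x y → (_≡_ {A = ℤ ±} [ y ] [ x ] → _≡_ {A = ℤ ±} [ y ] [ ℤ.0ℤ ]) →
             _≡_ {A = ℤ ±} [ ℤ.- x ] [ ℤ.- y ] → _≡_ {A = ℤ ±} [ ℤ.- x ] [ ℤ.0ℤ ]
neg-finite x y h e with ℤₚ.neg-injective (Extrema±.[_]-injective e)
... | refl with refl ← h refl = refl

negBound-nonAdjacent : ∀ l u → (supᴮ u ≡ infᴮ l → supᴮ u ≡ [ ℤ.0ℤ ]) →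
                       supᴮ (negBound l) ≡ infᴮ (negBound u) → supᴮ (negBound l) ≡ [ ℤ.0ℤ ]
negBound-nonAdjacent infinite u _ e = ⊥-elim (infᴮ≢⊤ (negBound u) e)
negBound-nonAdjacent l infinite _ e = ⊥-elim (supᴮ≢⊥ (negBound l) e)
negBound-nonAdjacent (excl x) (excl y) = neg-finite x y
negBound-nonAdjacent (excl x) (incl y) = neg-finite x y
negBound-nonAdjacent (incl x) (excl y) = neg-finite x y
negBound-nonAdjacent (incl x) (incl y) = neg-finite x y

-- Negation exchanges suprema and infima, so `neg I` meets `neg J` exactly where `J` meets `I`; the
-- exempt endpoint 0 is its own negative.
nonAdjacent-neg : ∀ I J → NonAdjacent J I → NonAdjacent (neg I) (neg J)
nonAdjacent-neg I J na e =
  trans (sup-bound (neg I))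
    (negBound-nonAdjacent (lower I) (upper J)
      (λ e′ → trans (sym (sup-bound J)) (na (trans (sup-bound J) (trans e′ (sym (inf-bound I))))))
      (trans (sym (sup-bound (neg I))) (trans e (inf-bound (neg J)))))

nonAdjacentSet-neg : ∀ {Ks} → NonAdjacentSet Ks → NonAdjacentSet (map neg Ks)
nonAdjacentSet-neg na I∈ J∈ with ∈-map⁻ neg I∈ | ∈-map⁻ neg J∈
... | I , I∈′ , refl | J , J∈′ , refl = nonAdjacent-neg I J (na J∈′ I∈′)

-- Segments of a timed word

-- `positions` is a filter of `allFin`, which hides that its entries are consecutive. A path makes
-- this explicit, gives the automaton arguments their recursion, and can be reversed.
data Path {X : Set} (Next : Rel X 0ℓ) : X → X → List X → Set where
  stop : ∀ {x} → Path Next x x (x ∷ [])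
  step : ∀ {x y z ps} → Next x y → Path Next y z ps → Path Next x z (x ∷ ps)

module _ {X : Set} {Next : Rel X 0ℓ} where

  path-∷ʳ : ∀ {x y z ps} → Path Next x y ps → Next y z → Path Next x z (ps ∷ʳ z)
  path-∷ʳ stop       e = step e stop
  path-∷ʳ (step d p) e = step d (path-∷ʳ p e)

path-reverse : ∀ {X : Set} {Next : Rel X 0ℓ} {x y ps} →
               Path Next x y ps → Path (flip Next) y x (reverse ps)
path-reverse stop = stop
path-reverse (step {x} {ps = ps} d p) rewrite unfold-reverse x ps = path-∷ʳ (path-reverse p) d

_⋖_ : ∀ {n} → Rel (Fin n) 0ℓ
x ⋖ y = toℕ y ≡ suc (toℕ x)

module _ {n : ℕ} where

  between? : ∀ (x y : ℕ) (j : Fin n) → Dec (x ℕ.≤ toℕ j × toℕ j ℕ.≤ y)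
  between? x y j = (x ≤? toℕ j) ×-dec (toℕ j ≤? y)

  -- The tails of `allFin` are tabulations of the numbers from some `c` on, hence the general `f`.
  -- Since `x` is at most `c`, the lower test always succeeds: this is the phase after the start of
  -- the segment has been reached.
  positions-from : ∀ {m} c (f : Fin (suc m) → Fin n) → (∀ j → toℕ (f j) ≡ c + toℕ j) →
                   ∀ j {x} → x ℕ.≤ c →
                   Path _⋖_ (f zero) (f j) (filter (between? x (toℕ (f j))) (tabulate f))
  positions-from c f f≡ zero {x} x≤c =
    subst (Path _⋖_ (f zero) (f zero))
      (sym (trans
        (filter-accept (between? x (toℕ (f zero)))
          (ℕₚ.≤-trans x≤c (ℕₚ.≤-reflexive (sym (trans (f≡ zero) (ℕₚ.+-identityʳ c)))) , ℕₚ.≤-refl))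
        (cong (f zero ∷_) (filter-none (between? x (toℕ (f zero))) (Allₚ.tabulate⁺ beyond)))))
      stop
    where
    beyond : ∀ j → ¬ (x ℕ.≤ toℕ (f (suc j)) × toℕ (f (suc j)) ℕ.≤ toℕ (f zero))
    beyond j (_ , le) =
      ℕₚ.m+n≮m c (toℕ j) (subst₂ ℕ._≤_ (trans (f≡ (suc j)) (ℕₚ.+-suc c (toℕ j)))
                                     (trans (f≡ zero) (ℕₚ.+-identityʳ c)) le)
  positions-from {suc m} c f f≡ (suc j) {x} x≤c =
    subst (Path _⋖_ (f zero) (f (suc j)))
      (sym (filter-accept (between? x (toℕ (f (suc j))))
        ( ℕₚ.≤-trans x≤c (ℕₚ.≤-trans (ℕₚ.m≤m+n c _) (ℕₚ.≤-reflexive (sym (f≡ zero))))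
        , subst₂ ℕ._≤_ (sym (f≡ zero)) (sym (f≡ (suc j))) (ℕₚ.+-monoʳ-≤ c ℕ.z≤n))))
      (step (trans (f≡ (suc zero)) (trans (ℕₚ.+-suc c 0) (cong suc (sym (f≡ zero)))))
        (positions-from (suc c) (f ∘ suc) (λ k → trans (f≡ (suc k)) (ℕₚ.+-suc c (toℕ k))) j
          (ℕₚ.m≤n⇒m≤1+n x≤c)))

  -- The phase before the start of the segment: entries below `f i` are rejected until `f i` heads
  -- the list.
  positions-between : ∀ {m} c (f : Fin m → Fin n) → (∀ j → toℕ (f j) ≡ c + toℕ j) →
                      ∀ i j → i Fin.≤ j →
                      Path _⋖_ (f i) (f j) (filter (between? (toℕ (f i)) (toℕ (f j))) (tabulate f))
  positions-between {suc m} c f f≡ zero j _ =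
    positions-from c f f≡ j (ℕₚ.≤-reflexive (trans (f≡ zero) (ℕₚ.+-identityʳ c)))
  positions-between {suc m} c f f≡ (suc i) (suc j) (ℕ.s≤s i≤j) =
    subst (Path _⋖_ (f (suc i)) (f (suc j)))
      (sym (filter-reject (between? (toℕ (f (suc i))) (toℕ (f (suc j)))) before))
      (positions-between (suc c) (f ∘ suc) (λ k → trans (f≡ (suc k)) (ℕₚ.+-suc c (toℕ k))) i j i≤j)
    where
    before : ¬ (toℕ (f (suc i)) ℕ.≤ toℕ (f zero) × toℕ (f zero) ℕ.≤ toℕ (f (suc j)))
    before (le , _) =
      ℕₚ.m+n≮m c (toℕ i) (subst₂ ℕ._≤_ (trans (f≡ (suc i)) (ℕₚ.+-suc c (toℕ i)))
                                     (trans (f≡ zero) (ℕₚ.+-identityʳ c)) le)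

  positions-path : ∀ {x y : Fin n} → x Fin.≤ y → Path _⋖_ x y (positions (toℕ x) (toℕ y))
  positions-path {x} {y} = positions-between 0 id (λ _ → refl) x y

-- The part of a word on one side of a position, read away from that position.
record Direction (n : ℕ) : Set₁ where
  field
    _⊑_ Next    : Rel (Fin n) 0ℓ
    ⊑-refl      : Reflexive _⊑_
    ⊑-trans     : Transitive _⊑_
    ⊑-total     : Total _⊑_
    _⊑?_        : Decidable _⊑_
    next⇒⊑      : ∀ {x y} → Next x y → x ⊑ y
    next⇒⋢      : ∀ {x y} → Next x y → ¬ (y ⊑ x)
    end         : Fin n
    ⊑-end       : ∀ x → x ⊑ end
    segment     : Fin n → Fin n → List (Fin n)
    path        : ∀ {x y} → x ⊑ y → Path Next x y (segment x y)
    lastSegment : Fin n → List (Fin n)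
    lastPath    : ∀ x → Path Next x end (lastSegment x)

  path⇒⊑ : ∀ {x y ps} → Path Next x y ps → x ⊑ y
  path⇒⊑ stop       = ⊑-refl
  path⇒⊑ (step d p) = ⊑-trans (next⇒⊑ d) (path⇒⊑ p)

⋖⇒≤ : ∀ {n} {x y : Fin n} → x ⋖ y → x Fin.≤ y
⋖⇒≤ e = ℕₚ.≤-trans (ℕₚ.n≤1+n _) (ℕₚ.≤-reflexive (sym e))

⋖⇒≰ : ∀ {n} {x y : Fin n} → x ⋖ y → ¬ (y Fin.≤ x)
⋖⇒≰ e le = ℕₚ.<-irrefl refl (ℕₚ.≤-trans (ℕₚ.≤-reflexive (sym e)) le)

-- The semantics of `𝓕` names the last position by the number `pred n`; carrying an equation for `e`
-- avoids forcing `n` to be a successor.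
forward : ∀ {n} {e : Fin n} → toℕ e ≡ pred n → Direction n
forward {n} {e} e≡ = record
  { _⊑_         = Fin._≤_
  ; Next        = _⋖_
  ; ⊑-refl      = ℕₚ.≤-refl
  ; ⊑-trans     = ℕₚ.≤-trans
  ; ⊑-total     = λ x y → ℕₚ.≤-total (toℕ x) (toℕ y)
  ; _⊑?_        = Fin._≤?_
  ; next⇒⊑      = λ {x} {y} → ⋖⇒≤ {x = x} {y}
  ; next⇒⋢      = λ {x} {y} → ⋖⇒≰ {x = x} {y}
  ; end         = e
  ; ⊑-end       = ≤e
  ; segment     = λ x y → positions (toℕ x) (toℕ y)
  ; path        = positions-path
  ; lastSegment = λ x → positions (toℕ x) (pred n)
  ; lastPath    = λ x → subst (λ k → Path _⋖_ x e (positions (toℕ x) k)) e≡ (positions-path (≤e x))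
  }
  where
  ≤e : ∀ x → x Fin.≤ e
  ≤e x = subst (toℕ x ℕ.≤_) (sym e≡) (Finₚ.toℕ≤pred[n] x)

backward : ∀ {n} {b : Fin n} → toℕ b ≡ 0 → Direction n
backward {n} {b} b≡ = record
  { _⊑_         = flip Fin._≤_
  ; Next        = flip _⋖_
  ; ⊑-refl      = ℕₚ.≤-refl
  ; ⊑-trans     = flip ℕₚ.≤-trans
  ; ⊑-total     = λ x y → ℕₚ.≤-total (toℕ y) (toℕ x)
  ; _⊑?_        = flip Fin._≤?_
  ; next⇒⊑      = λ {x} {y} → ⋖⇒≤ {x = y} {x}
  ; next⇒⋢      = λ {x} {y} → ⋖⇒≰ {x = y} {x}
  ; end         = b
  ; ⊑-end       = b≤
  ; segment     = λ x y → reverse (positions (toℕ y) (toℕ x))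
  ; path        = λ y≤x → path-reverse (positions-path y≤x)
  ; lastSegment = λ x → reverse (positions 0 (toℕ x))
  ; lastPath    = λ x → subst (λ k → Path (flip _⋖_) x b (reverse (positions k (toℕ x)))) b≡
                          (path-reverse (positions-path (b≤ x)))
  }
  where
  b≤ : ∀ x → b Fin.≤ x
  b≤ x = subst (ℕ._≤ toℕ x) (sym b≡) ℕ.z≤n

lastPosition : ∀ {n} → Fin n → ∃[ e ] toℕ {n} e ≡ pred n
lastPosition {suc n} _ = fromℕ n , Finₚ.toℕ-fromℕ n

firstPosition : ∀ {n} → Fin n → ∃[ b ] toℕ {n} b ≡ 0
firstPosition {suc n} _ = zero , refl

-- Parametrised by the order, so that the flipped order gives the last witness.
module Extrema {X : Set} (_⊑_ : Rel X 0ℓ) (⊑-refl : Reflexive _⊑_) (⊑-trans : Transitive _⊑_)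
               (⊑-total : Total _⊑_) {P : X → Set} (P? : ∀ x → Dec (P x)) where

  minimum : ∀ xs → (∃[ a ] P a × All (λ x → P x → a ⊑ x) xs) ⊎ All (¬_ ∘ P) xs
  minimum [] = inj₂ []
  minimum (x ∷ xs) with P? x | minimum xs
  ... | no ¬p | inj₁ (a , pa , h) = inj₁ (a , pa , ⊥-elim ∘ ¬p ∷ h)
  ... | no ¬p | inj₂ h            = inj₂ (¬p ∷ h)
  ... | yes p | inj₂ h            = inj₁ (x , p , (λ _ → ⊑-refl) ∷ All.map (λ ¬q q → ⊥-elim (¬q q)) h)
  ... | yes p | inj₁ (a , pa , h) with ⊑-total x a
  ...   | inj₁ x⊑a = inj₁ (x , p , (λ _ → ⊑-refl) ∷ All.map (λ a⊑ q → ⊑-trans x⊑a (a⊑ q)) h)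
  ...   | inj₂ a⊑x = inj₁ (a , pa , (λ _ → a⊑x) ∷ h)

-- Joints between which finitely many convex constraints behave uniformly

module Joints {n} (dir : Direction n) where
  open Direction dir

  -- A subdivision of the positions from x to the end by k interior joints.
  data Joint : Fin n → ℕ → Set where
    last : ∀ {x} → Joint x 0
    step : ∀ {x y k} → x ⊑ y → Joint y k → Joint x (suc k)

  ForSegments : (Fin n → Fin n → Set) → ∀ {x k} → Joint x k → Set
  ForSegments R (last {x})          = R x end
  ForSegments R (step {x} {y} _ js) = R x y × ForSegments R js

  forSegments-map : ∀ {R S} → (∀ {x y} → R x y → S x y) →
                    ∀ {x k} (js : Joint x k) → ForSegments R js → ForSegments S js
  forSegments-map f last        r        = f r
  forSegments-map f (step _ js) (r , rs) = f r , forSegments-map f js rs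

  later : ∀ {x k} → Joint x k → Vec (Fin n) (1 + k)
  later last                = end ∷ []
  later (step {y = y} _ js) = y ∷ later js

  vertices : ∀ {x k} → Joint x k → Vec (Fin n) (2 + k)
  vertices {x} js = x ∷ later js

  -- Joints are inserted one after another, so whatever has been achieved for a segment must survive
  -- its being split.
  Subdivisible : (Fin n → Fin n → Set) → Set
  Subdivisible R = ∀ {x p y} → x ⊑ p → p ⊑ y → R x y → R x p × R p y

  -- A positive way to say that `p` is not strictly inside the segment.
  Outside : Fin n → Fin n → Fin n → Set
  Outside p x y = p ⊑ x ⊎ y ⊑ p

  outside-subdivisible : ∀ p → Subdivisible (Outside p)
  outside-subdivisible p x⊑q q⊑y (inj₁ p⊑x) = inj₁ p⊑x , inj₁ (⊑-trans p⊑x x⊑q)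
  outside-subdivisible p x⊑q q⊑y (inj₂ y⊑p) = inj₂ (⊑-trans q⊑y y⊑p) , inj₂ y⊑p

  insert : ∀ p {x k} → x ⊑ p → Joint x k → Joint x (suc k)
  insert p x⊑p last = step x⊑p last
  insert p x⊑p (step {y = y} x⊑y js) with ⊑-total p y
  ... | inj₁ p⊑y = step x⊑p (step p⊑y js)
  ... | inj₂ y⊑p = step x⊑y (insert p y⊑p js)

  after-outside : ∀ p {R x k} → p ⊑ x → (js : Joint x k) → ForSegments R js →
                  ForSegments (λ y z → R y z × Outside p y z) js
  after-outside p p⊑x last           r        = r , inj₁ p⊑x
  after-outside p p⊑x (step x⊑y js) (r , rs) =
    (r , inj₁ p⊑x) , after-outside p (⊑-trans p⊑x x⊑y) js rs

  -- Only the segment into which `p` falls is split, which `R` survives. The segments before it end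
  -- before `p`, those after it start after `p`.
  insert-outside : ∀ p {R x k} → Subdivisible R → (x⊑p : x ⊑ p) (js : Joint x k) →
                   ForSegments R js →
                   ForSegments (λ y z → R y z × Outside p y z) (insert p x⊑p js)
  insert-outside p sub x⊑p last r with sub x⊑p (⊑-end p) r
  ... | r₁ , r₂ = (r₁ , inj₂ ⊑-refl) , (r₂ , inj₁ ⊑-refl)
  insert-outside p sub x⊑p (step {y = y} x⊑y js) (r , rs) with ⊑-total p y
  ... | inj₂ y⊑p = (r , inj₂ y⊑p) , insert-outside p sub y⊑p js rs
  ... | inj₁ p⊑y with sub x⊑p p⊑y r
  ...   | r₁ , r₂ = (r₁ , inj₂ ⊑-refl) , (r₂ , inj₁ ⊑-refl) , after-outside p p⊑y js rs

  module _ {A : Set} (Holds : A → Fin n → Set) (holds? : ∀ a x → Dec (Holds a x))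
           (convex : ∀ a {x y z} → x ⊑ y → y ⊑ z → Holds a x → Holds a z → Holds a y)
           (i : Fin n) where

    -- A constraint true strictly inside the segment is true at both ends, which is what a segment
    -- automaton can check. The guard `i ⊑ z` reflects that extremes are sought only among the
    -- positions from `i` on.
    Uniform : A → Fin n → Fin n → Set
    Uniform a x y = ∀ z → i ⊑ z → x ⊑ z → z ⊑ y → ¬ (z ⊑ x) → ¬ (y ⊑ z) →
                    Holds a z → Holds a x × Holds a y

    -- The old ends satisfy the constraint by `u`; the new joint `p` does so by convexity, between
    -- the interior position and the end on the other side of `p`.
    uniform-subdivisible : ∀ a → Subdivisible (Uniform a)
    uniform-subdivisible a x⊑p p⊑y u =
      ( λ z iz xz zp z⋢x p⋢z hz →
          let hx , hy = u z iz xz (⊑-trans zp p⊑y) z⋢x (λ yz → p⋢z (⊑-trans p⊑y yz)) hz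
          in hx , convex a zp p⊑y hz hy )
      , λ z iz pz zy z⋢p y⋢z hz →
          let hx , hy = u z iz (⊑-trans x⊑p pz) zy (λ zx → z⋢p (⊑-trans zx x⊑p)) y⋢z hz
          in convex a x⊑p pz hx hz , hy

    -- The first witness `b` does not come after `z` and is not strictly inside, so `x` lies between
    -- `b` and `z`. Symmetrically, `y` lies between `z` and the last witness `c`.
    extremes⇒uniform : ∀ a {b c} → Holds a b → Holds a c →
                       (∀ z → i ⊑ z → Holds a z → b ⊑ z) → (∀ z → i ⊑ z → Holds a z → z ⊑ c) →
                       ∀ {x y} → Outside b x y → Outside c x y → Uniform a x y
    extremes⇒uniform a hb hc min max ob oc z iz xz zy z⋢x y⋢z hz = left ob , right oc
      where
      left : Outside _ _ _ → Holds a _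
      left (inj₁ b⊑x) = convex a b⊑x xz hb hz
      left (inj₂ y⊑b) = ⊥-elim (y⋢z (⊑-trans y⊑b (min z iz hz)))
      right : Outside _ _ _ → Holds a _
      right (inj₁ c⊑x) = ⊥-elim (z⋢x (⊑-trans (max z iz hz) c⊑x))
      right (inj₂ y⊑c) = convex a zy y⊑c hz hc

    AllUniform : List A → Fin n → Fin n → Set
    AllUniform as x y = All (λ a → Uniform a x y) as

    allUniform-subdivisible : ∀ as → Subdivisible (AllUniform as)
    allUniform-subdivisible as xp py us =
      All.map (λ {a} u → proj₁ (uniform-subdivisible a xp py u)) us ,
      All.map (λ {a} u → proj₂ (uniform-subdivisible a xp py u)) us

    uniformJoints : ∀ as → Σ[ js ∈ Joint i (length as * 2) ] ForSegments (AllUniform as) js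
    uniformJoints [] = last , []
    uniformJoints (a ∷ as)
      with uniformJoints as
         | Extrema.minimum _⊑_ ⊑-refl ⊑-trans ⊑-total (λ x → (i ⊑? x) ×-dec holds? a x) (allFin n)
         | Extrema.minimum (flip _⊑_) ⊑-refl (flip ⊑-trans) (flip ⊑-total)
             (λ x → (i ⊑? x) ×-dec holds? a x) (allFin n)
    ... | js , us | inj₁ (b , (ib , hb) , min) | inj₁ (c , (ic , hc) , max) =
      insert c ic (insert b ib js) ,
      forSegments-map
        (λ ((u , ob) , oc) →
          extremes⇒uniform a hb hc
            (λ z iz hz → All.lookup min (∈-allFin z) (iz , hz))
            (λ z iz hz → All.lookup max (∈-allFin z) (iz , hz)) ob oc ∷ u)
        (insert c ic (insert b ib js))
        (insert-outside c
          (λ xp py (u , o) →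
            let u₁ , u₂ = allUniform-subdivisible as xp py u
                o₁ , o₂ = outside-subdivisible b xp py o
            in (u₁ , o₁) , (u₂ , o₂))
          ic (insert b ib js)
          (insert-outside b (allUniform-subdivisible as) ib js us))
    ... | js , us | inj₂ none | _ = vacuous js us none
      where
      vacuous : ∀ js → ForSegments (AllUniform as) js →
                All (λ x → ¬ (i ⊑ x × Holds a x)) (allFin n) →
                Σ[ js ∈ Joint i _ ] ForSegments (AllUniform (a ∷ as)) js
      -- The number of joints must not depend on the word, so a constraint without witnesses is
      -- padded with two joints at `i`.
      vacuous js us none = step ⊑-refl (step ⊑-refl js) ,
        trivial , trivial ,
        forSegments-map (λ u → none′ ∷ u) js us
        where
        none′ : ∀ {x y} → Uniform a x y
        none′ z iz _ _ _ _ hz = ⊥-elim (All.lookup none (∈-allFin z) (iz , hz))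
        trivial : AllUniform (a ∷ as) i i
        trivial = All.tabulate λ _ z iz iz′ zi z⋢i → ⊥-elim (z⋢i zi)
    ... | js , us | inj₁ (b , hb , _) | inj₂ none = ⊥-elim (All.lookup none (∈-allFin b) hb)

-- A labelling of the positions from x to the end, given as it is unfolded
-- from x: from a chain in each direction, soundness needs no global labelling.
data Chain {n} (dir : Direction n) {Q : Set} (Good : Fin n → Q → Set)
           (Step : Q → Q → Set) (End : Q → Set) : Fin n → Q → Set where
  stop : ∀ {q} → let open Direction dir in
         Good end q → End q → Chain dir Good Step End end q
  step : ∀ {x y q r} → let open Direction dir in
         Good x q → Next x y → Step q r → Chain dir Good Step End y r → Chain dir Good Step End x q

module _ {n} {dir : Direction n} where

  chain-map : ∀ {Q R : Set} (f : Q → R) {G : Fin n → Q → Set} {G′ : Fin n → R → Set}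
              {S : Q → Q → Set} {S′ : R → R → Set} {E : Q → Set} {E′ : R → Set} →
              (∀ {x q} → G x q → G′ x (f q)) → (∀ {q r} → S q r → S′ (f q) (f r)) →
              (∀ {q} → E q → E′ (f q)) →
              ∀ {x q} → Chain dir G S E x q → Chain dir G′ S′ E′ x (f q)
  chain-map f g s e (stop a b)     = stop (g a) (e b)
  chain-map f g s e (step a d b c) = step (g a) d (s b) (chain-map f g s e c)

  chain-good : ∀ {Q : Set} {G : Fin n → Q → Set} {S : Q → Q → Set} {E : Q → Set} {x q} →
               Chain dir G S E x q → G x q
  chain-good (stop g _)     = g
  chain-good (step g _ _ _) = g

-- Enumerations and their sizes

vectors : ∀ {A : Set} → List A → ∀ k → List (Vec A k)
vectors xs zero    = [] ∷ []
vectors xs (suc k) = cartesianProductWith _∷_ xs (vectors xs k)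

∈-vectors : ∀ {A : Set} {xs : List A} → (∀ x → x ∈ xs) → ∀ {k} (v : Vec A k) → v ∈ vectors xs k
∈-vectors all []      = here refl
∈-vectors all (x ∷ v) = ∈-cartesianProductWith⁺ _∷_ (all x) (∈-vectors all v)

bools : List Bool
bools = true ∷ false ∷ []

∈-bools : ∀ b → b ∈ bools
∈-bools true  = here refl
∈-bools false = there (here refl)

open ℕₚ hiding (_≤?_; _≟_; _<?_)
open ℕₚ.≤-Reasoning using (begin_; _∎; step-≤; step-≡-⟩; step-≡-⟨; step-≡-∣)

length-cartesianProductWith : ∀ {A B C : Set} (f : A → B → C) xs ys →
                              length (cartesianProductWith f xs ys) ≡ length xs * length ys
length-cartesianProductWith f []       ys = refl
length-cartesianProductWith f (x ∷ xs) ys =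
  trans (length-++ (map (f x) ys))
    (cong₂ _+_ (length-map (f x) ys) (length-cartesianProductWith f xs ys))

length-vectors : ∀ {A : Set} (xs : List A) k → length (vectors xs k) ≡ length xs ^ k
length-vectors xs zero    = refl
length-vectors xs (suc k) =
  trans (length-cartesianProductWith _∷_ xs (vectors xs k)) (cong (length xs *_) (length-vectors xs k))

length-allFin : ∀ n → length (allFin n) ≡ n
length-allFin n = length-tabulate id

sum-≤ : ∀ {n} (f : Vector ℕ n) {B} → (∀ i → f i ≤ B) → sum f ≤ n * B
sum-≤ {zero}  f h = z≤n
sum-≤ {suc n} f h = +-mono-≤ (h zero) (sum-≤ (f ∘ suc) (h ∘ suc))

maximum-≤ : ∀ {n} (f : Vector ℕ n) {B} → (∀ i → f i ≤ B) → maximum f ≤ B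
maximum-≤ {zero}  f h = z≤n
maximum-≤ {suc n} f h = ⊔-lub (h zero) (maximum-≤ (f ∘ suc) (h ∘ suc))

-- Opaque, since deciding 2 ^ suc a = 2 ^ suc b by evaluation takes exponential time.
opaque
  exp₂ : ℕ → ℕ
  exp₂ n = 2 ^ n

  exp₂-def : ∀ n → exp₂ n ≡ 2 ^ n
  exp₂-def n = refl

  exp₂-0 : exp₂ 0 ≡ 1
  exp₂-0 = refl

  exp₂-mono : ∀ {a b} → a ≤ b → exp₂ a ≤ exp₂ b
  exp₂-mono = ^-monoʳ-≤ 2

  *-exp₂ : ∀ {x y a b} → x ≤ exp₂ a → y ≤ exp₂ b → x * y ≤ exp₂ (a + b)
  *-exp₂ {a = a} {b} p q = ≤-trans (*-mono-≤ p q) (≤-reflexive (sym (^-distribˡ-+-* 2 a b)))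

  +-exp₂ : ∀ {x y a} → x ≤ exp₂ a → y ≤ exp₂ a → x + y ≤ exp₂ (suc a)
  +-exp₂ {a = a} p q = ≤-trans (+-mono-≤ p q) (≤-reflexive (cong ((2 ^ a) +_) (sym (+-identityʳ (2 ^ a)))))

  ^-exp₂ : ∀ {x a} k → x ≤ exp₂ a → x ^ k ≤ exp₂ (a * k)
  ^-exp₂ {a = a} k p = ≤-trans (^-monoˡ-≤ k p) (≤-reflexive (^-*-assoc 2 a k))

  -- The coefficients of the exponent collected in `translation-size`.
  sizePoly : List ℕ
  sizePoly = 13 ∷ 13 ∷ 8 ∷ []

  evalPoly-sizePoly : ∀ e → evalPoly sizePoly e ≡ 13 + 13 * e + 8 * (e * e)
  evalPoly-sizePoly = expanded
    where
    expanded : ∀ e → 13 + e * (13 + e * (8 + e * 0)) ≡ 13 + 13 * e + 8 * (e * e)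
    expanded = solve-∀

1≤exp₂ : ∀ a → 1 ≤ exp₂ a
1≤exp₂ a = ≤-trans (≤-reflexive (sym exp₂-0)) (exp₂-mono {0} {a} z≤n)

n≤exp₂n : ∀ n → n ≤ exp₂ n
n≤exp₂n zero    = z≤n
n≤exp₂n (suc n) = +-exp₂ (1≤exp₂ n) (n≤exp₂n n)

2≤exp₂1 : 2 ≤ exp₂ 1
2≤exp₂1 = +-exp₂ {1} {1} (1≤exp₂ 0) (1≤exp₂ 0)

length-product-exp₂ : ∀ {A B : Set} (xs : List A) (ys : List B) {a b} →
                      length xs ≤ exp₂ a → length ys ≤ exp₂ b →
                      length (cartesianProduct xs ys) ≤ exp₂ (a + b)
length-product-exp₂ xs ys p q rewrite length-cartesianProductWith _,_ xs ys = *-exp₂ p q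

-- Automata for the segments between joints

module Segments {N m : ℕ}
  (Loc : Fin N → Subset m → Set) (loc? : ∀ q s → Dec (Loc q s))
  (Step : Fin N → Fin N → Set) (step? : ∀ q r → Dec (Step q r))
  (End : Fin N → Set) (end? : ∀ q → Dec (End q))
  (clk : Fin N → List Interval) where

  -- A type with contradictory claims has no intersection to assert at a joint. Refusing it here
  -- makes the junk value of `meet` harmless.
  Read : Fin N → Subset m → Set
  Read q s = Loc q s × Consistent (clk q)

  read? : ∀ q s → Dec (Read q s)
  read? q s = loc? q s ×-dec consistent? (clk q)

  -- In mid q a letter of type q has been read and the segment goes on.
  pattern start = zero
  pattern done  = suc zero
  pattern mid q = suc (suc q)

  module Build (Δ : Fin (2 + N) → Subset m → Fin (2 + N) → Set)
               (Δ? : ∀ p s q → Dec (Δ p s q)) where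

    Δ′ : Fin (2 + N) × Subset m × Fin (2 + N) → Set
    Δ′ (p , s , q) = Δ p s q

    Δ′? : ∀ t → Dec (Δ′ t)
    Δ′? (p , s , q) = Δ? p s q

    triples : List (Fin (2 + N) × Subset m × Fin (2 + N))
    triples = cartesianProduct (allFin (2 + N)) (cartesianProduct (vectors bools m) (allFin (2 + N)))

    nfa : NFA m
    nfa = record
      { states      = 2 + N
      ; initial     = start
      ; final       = ⁅ done ⁆
      ; transitions = filter Δ′? triples
      }

    transition⁺ : ∀ {p s q} → Δ′ (p , s , q) → (p , s , q) ∈ NFA.transitions nfa
    transition⁺ {p} {s} {q} =
      ∈-filter⁺ Δ′? (∈-cartesianProduct⁺ (∈-allFin p)
                      (∈-cartesianProduct⁺ (∈-vectors ∈-bools s) (∈-allFin q)))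

    transition⁻ : ∀ {p s q} → (p , s , q) ∈ NFA.transitions nfa → Δ p s q
    transition⁻ t∈ = proj₂ (∈-filter⁻ Δ′? {xs = triples} t∈)

    final⁺ : done Subset.∈ NFA.final nfa
    final⁺ = Subsetₚ.x∈⁅x⁆ _

    final⁻ : ∀ {q} → q Subset.∈ NFA.final nfa → q ≡ done
    final⁻ = Subsetₚ.x∈⁅y⁆⇒x≡y _

    accepts⁻ : ∀ {p s w} → AcceptsFrom nfa p (s ∷ w) → ∃[ q ] Δ p s q × AcceptsFrom nfa q w
    accepts⁻ (q , t∈ , acc) = q , transition⁻ t∈ , acc

    accepts⁺ : ∀ {p s q w} → Δ p s q → AcceptsFrom nfa q w → AcceptsFrom nfa p (s ∷ w)
    accepts⁺ δ acc = _ , transition⁺ δ , acc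

  -- Clock constraints true at both ends of a segment are true throughout it.
  -- The two end letters are exempt: their constraints are asserted by the
  -- modality itself.
  Interior : Fin N → Fin N → Fin N → Set
  Interior q₀ q₁ q = All (_∈ clk q₀) (clk q) × All (_∈ clk q₁) (clk q)

  -- Accepts single letters only. As the first automaton it forces the first joint onto the current
  -- position, whose claims are thereby asserted; as the last one it forces the last joint onto the
  -- end of the word and checks the boundary condition `E` there.
  SingleΔ : Set → Fin N → Fin (2 + N) → Subset m → Fin (2 + N) → Set
  SingleΔ E q start s done = E × Read q s
  SingleΔ E q _     _ _    = ⊥

  singleΔ? : ∀ {E} → Dec E → ∀ q p s r → Dec (SingleΔ E q p s r)
  singleΔ? e? q start   s start   = no λ ()
  singleΔ? e? q start   s done    = e? ×-dec read? q s
  singleΔ? e? q start   s (mid _) = no λ ()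
  singleΔ? e? q done    s r       = no λ ()
  singleΔ? e? q (mid _) s r       = no λ ()

  -- Neighbouring segments share the letter of their joint, so both end letters are read. Joints may
  -- coincide: the first rule handles the segment of one letter, where the two types must agree.
  SegmentΔ : Fin N → Fin N → Fin (2 + N) → Subset m → Fin (2 + N) → Set
  SegmentΔ q₀ q₁ start   s done    = q₀ ≡ q₁ × Read q₀ s
  SegmentΔ q₀ q₁ start   s (mid q) = q ≡ q₀ × Read q₀ s
  SegmentΔ q₀ q₁ (mid q) s done    = Step q q₁ × Read q₁ s
  SegmentΔ q₀ q₁ (mid q) s (mid r) = Step q r × Read r s × Interior q₀ q₁ r
  SegmentΔ q₀ q₁ _       s _       = ⊥

  segmentΔ? : ∀ q₀ q₁ p s r → Dec (SegmentΔ q₀ q₁ p s r)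
  segmentΔ? q₀ q₁ start   s start   = no λ ()
  segmentΔ? q₀ q₁ start   s done    = (q₀ Fin.≟ q₁) ×-dec read? q₀ s
  segmentΔ? q₀ q₁ start   s (mid q) = (q Fin.≟ q₀) ×-dec read? q₀ s
  segmentΔ? q₀ q₁ done    s start   = no λ ()
  segmentΔ? q₀ q₁ done    s done    = no λ ()
  segmentΔ? q₀ q₁ done    s (mid _) = no λ ()
  segmentΔ? q₀ q₁ (mid q) s start   = no λ ()
  segmentΔ? q₀ q₁ (mid q) s done    = step? q q₁ ×-dec read? q₁ s
  segmentΔ? q₀ q₁ (mid q) s (mid r) =
    step? q r ×-dec read? r s ×-dec
    All.all? (_∈ᴵ? clk q₀) (clk r) ×-dec All.all? (_∈ᴵ? clk q₁) (clk r)

  module Single (E : Set) (e? : Dec E) (q : Fin N) = Build (SingleΔ E q) (singleΔ? e? q)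
  module Segment (q₀ q₁ : Fin N) = Build (SegmentΔ q₀ q₁) (segmentΔ? q₀ q₁)

  firstNFA lastNFA : Fin N → NFA m
  firstNFA q = Single.nfa ⊤ (yes tt) q
  lastNFA  q = Single.nfa (End q) (end? q) q

  segmentNFA : Fin N → Fin N → NFA m
  segmentNFA = Segment.nfa

  segmentNFAs : ∀ {k} → Vec (Fin N) (suc k) → Vector (NFA m) (suc k)
  segmentNFAs (q ∷ [])     zero    = lastNFA q
  segmentNFAs (q ∷ r ∷ qs) zero    = segmentNFA q r
  segmentNFAs (q ∷ r ∷ qs) (suc w) = segmentNFAs (r ∷ qs) w

  automata : ∀ {k} → Vec (Fin N) (suc k) → Vector (NFA m) (suc (suc k))
  automata v zero    = firstNFA (head v)
  automata v (suc w) = segmentNFAs v w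

  jointIntervals : ∀ {k} → Vec (Fin N) k → Vector Interval k
  jointIntervals v w = meet (clk (Vec.lookup v w))

  module _ {e : ℕ} (N≤ : N ≤ exp₂ (2 * e)) (m≤ : m ≤ e) where

    states≤ : 2 + N ≤ exp₂ (2 + 2 * e)
    states≤ = +-exp₂ {a = 1 + 2 * e} (≤-trans 2≤exp₂1 (exp₂-mono (s≤s z≤n))) (≤-trans N≤ (exp₂-mono (n≤1+n _)))

    letters≤ : length (vectors bools m) ≤ exp₂ e
    letters≤ rewrite length-vectors bools m =
      ≤-trans (^-exp₂ m 2≤exp₂1) (exp₂-mono (≤-trans (≤-reflexive (+-identityʳ m)) m≤))

    allFin≤ : length (allFin (2 + N)) ≤ exp₂ (2 + 2 * e)
    allFin≤ rewrite length-allFin (2 + N) = states≤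

    -- The transitions are among the triples of state, letter and state, which gives the exponent
    -- `4 + 5 * e`; the number of states costs one more doubling.
    nfa-size : ∀ Δ Δ? → sizeᴬ (Build.nfa Δ Δ?) ≤ exp₂ (5 + 5 * e)
    nfa-size Δ Δ? = begin
      sizeᴬ nfa             ≤⟨ +-mono-≤ states≤′ (≤-trans (length-filter Δ′? triples) triples≤) ⟩
      exp₂ a + exp₂ a       ≤⟨ +-exp₂ {a = a} ≤-refl ≤-refl ⟩
      exp₂ (suc a)          ≡⟨ cong exp₂ (eq e) ⟩
      exp₂ (5 + 5 * e)      ∎
      where
      open Build Δ Δ?
      a : ℕ
      a = (2 + 2 * e) + (e + (2 + 2 * e))
      states≤′ : 2 + N ≤ exp₂ a
      states≤′ = ≤-trans states≤ (exp₂-mono (m≤m+n _ _))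
      pairs : List (Subset m × Fin (2 + N))
      pairs = cartesianProduct (vectors bools m) (allFin (2 + N))
      pairs≤ : length pairs ≤ exp₂ (e + (2 + 2 * e))
      pairs≤ = length-product-exp₂ (vectors bools m) (allFin (2 + N)) letters≤ allFin≤
      triples≤ : length triples ≤ exp₂ a
      triples≤ = length-product-exp₂ (allFin (2 + N)) pairs allFin≤ pairs≤
      eq : ∀ e → suc ((2 + 2 * e) + (e + (2 + 2 * e))) ≡ 5 + 5 * e
      eq = solve-∀

    segments-size : ∀ {k} (v : Vec (Fin N) (suc k)) w → sizeᴬ (segmentNFAs v w) ≤ exp₂ (5 + 5 * e)
    segments-size (q ∷ [])    zero    = nfa-size _ (singleΔ? (end? q) q)
    segments-size (q ∷ r ∷ v) zero    = nfa-size _ (segmentΔ? q r)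
    segments-size (q ∷ r ∷ v) (suc w) = segments-size (r ∷ v) w

    automata-size : ∀ {k} (v : Vec (Fin N) (suc k)) w → sizeᴬ (automata v w) ≤ exp₂ (5 + 5 * e)
    automata-size (q ∷ v) zero    = nfa-size _ (singleΔ? (yes _) q)
    automata-size v       (suc w) = segments-size v w

  -- Runs of types and modalities along one direction

  module Line {n} (dir : Direction n) (ℝ : RealNumbers)
    (D : Fin n → RealNumbers.Carrier ℝ)
    (D-mono : ∀ {x y} → Direction._⊑_ dir x y → RealNumbers._≤_ ℝ (D x) (D y))
    (Sat : Fin m → Fin n → Set) where

    open Direction dir
    open OrderedField ℝ using (inInterval-convex; inInterval?)

    -- `D` stands for the distance in time from the current position, `τ x - τ i` forwards and
    -- `τ i - τ x` backwards, so that it grows along `⊑` either way.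
    In : Fin n → Interval → Set
    In x J = InInterval ℝ (D x) J

    Good : Fin n → Fin N → Set
    Good x q = (∃[ s ] IsLetter Sat x s × Loc q s) × All (In x) (clk q)

    Run : Fin n → Fin N → Set
    Run = Chain dir Good Step End

    Word∈ : List (Fin n) → NFA m → Set
    Word∈ xs A = ∃[ w ] Pointwise (IsLetter Sat) xs w × Accepts A w

    Reads : Fin n → Fin N → Set
    Reads x q = ∃[ s ] IsLetter Sat x s × Read q s

    path-head : ∀ {x y ps s w} → Path Next x y ps → Pointwise (IsLetter Sat) ps (s ∷ w) → IsLetter Sat x s
    path-head stop       (l ∷ _) = l
    path-head (step _ _) (l ∷ _) = l

    module _ {E : Set} (e? : Dec E) {q : Fin N} where
      open Single E e? q

      single-sound : ∀ {x y ps} → Path Next x y ps → Word∈ ps nfa → x ≡ y × E × Reads x q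
      single-sound stop (s ∷ [] , l ∷ [] , acc) with accepts⁻ acc
      ... | done , (e , r) , _ = refl , e , s , l , r
      single-sound (step _ stop) (_ ∷ _ ∷ [] , _ ∷ _ ∷ [] , acc) with accepts⁻ acc
      ... | done , _ , acc′ with accepts⁻ acc′
      ...   | _ , () , _
      single-sound (step _ (step _ _)) (_ ∷ _ ∷ _ , _ ∷ _ ∷ _ , acc) with accepts⁻ acc
      ... | done , _ , acc′ with accepts⁻ acc′
      ...   | _ , () , _

    good : ∀ {x q} → Reads x q → In x (meet (clk q)) → Good x q
    good (s , l , loc , c) p = (s , l , loc) , ∈meet⁻ ℝ _ c p

    module _ {q₀ q₁ : Fin N} where
      open Segment q₀ q₁

      done-last : ∀ {x y ps s w} → Path Next x y ps → Pointwise (IsLetter Sat) ps (s ∷ w) →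
                  AcceptsFrom nfa done w → x ≡ y
      done-last stop                _           _ = refl
      done-last (step _ stop)       (_ ∷ _ ∷ _) acc with accepts⁻ acc
      ... | _ , () , _
      done-last (step _ (step _ _)) (_ ∷ _ ∷ _) acc with accepts⁻ acc
      ... | _ , () , _

      -- The run is extended backwards from the one at the far end `y`. An interior claim is also a
      -- claim of `q₀`, true at `x`, and of `q₁`, true at `y`; convexity carries it to the position
      -- in between.
      interior-sound : ∀ {x y z q ps s} w → x ⊑ z → All (In x) (clk q₀) → Run y q₁ →
                       Good z q → Path Next z y ps →
                       Pointwise (IsLetter Sat) ps (s ∷ w) → AcceptsFrom nfa (mid q) w → Run z q
      interior-sound [] _ _ _ _ _ _ f∈ with () ← final⁻ f∈
      interior-sound (s ∷ w) x⊑z inx run g stop (_ ∷ ()) acc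
      interior-sound {x} (s ∷ w) x⊑z inx run g (step {y = z′} d p) (_ ∷ ls) acc with accepts⁻ acc
      ... | done , (st , _) , acc′ with refl ← done-last p ls acc′ = step g d st run
      ... | mid r , (st , (loc , _) , in₀ , in₁) , acc′ =
        step g d st (interior-sound w x⊑z′ inx run ((s , path-head p ls , loc) , clocks) p ls acc′)
        where
        x⊑z′ : x ⊑ z′
        x⊑z′ = ⊑-trans x⊑z (next⇒⊑ d)
        clocks : All (In z′) (clk r)
        clocks = All.tabulate λ {J} J∈ →
          inInterval-convex J (D-mono x⊑z′) (D-mono (path⇒⊑ p))
            (All.lookup inx (All.lookup in₀ J∈))
            (All.lookup (proj₂ (chain-good run)) (All.lookup in₁ J∈))

      segment-sound : ∀ {x y ps} → Path Next x y ps → Word∈ ps nfa → In x (meet (clk q₀)) →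
                      Run y q₁ → Run x q₀
      segment-sound p ([] , _ , f∈) inx run with () ← final⁻ f∈
      segment-sound p (s ∷ w , ls , acc) inx run with accepts⁻ acc
      ... | done , (refl , _) , acc′ with refl ← done-last p ls acc′ = run
      ... | mid q , (refl , r) , acc′ =
        let g = good (s , path-head p ls , r) inx
        in interior-sound w ⊑-refl (proj₂ g) run g p ls acc′

    -- The modality from its first joint on, in a form that recurses over the joints. The interval
    -- of the leading joint is left out: it is asserted by the preceding link.
    Link : ∀ {k} → Vec (Fin N) (suc k) → Vector (Fin n) (suc k) → Set
    Link {k} v is =
      (∀ (w : Fin k) → is (inject₁ w) ⊑ is (suc w) ×
                       In (is (suc w)) (jointIntervals v (suc w)) ×
                       Word∈ (segment (is (inject₁ w)) (is (suc w))) (segmentNFAs v (inject₁ w))) ×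
      Word∈ (lastSegment (is (fromℕ k))) (segmentNFAs v (fromℕ k))

    link-sound : ∀ {k} (v : Vec (Fin N) (suc k)) (is : Vector (Fin n) (suc k)) → Link v is →
                 In (is zero) (jointIntervals v zero) → Run (is zero) (head v)
    link-sound (q ∷ []) is (_ , wd) inx with single-sound (end? q) (lastPath (is zero)) wd
    ... | refl , e , r = stop (good r inx) e
    link-sound (q ∷ r ∷ v) is (h , wd) inx =
      let x⊑y , iny , seg = h zero
      in segment-sound (path x⊑y) seg inx (link-sound (r ∷ v) (is ∘ suc) (h ∘ suc , wd) iny)

    Modality : ∀ {k} → Vec (Fin N) (suc k) → Fin n → Set
    Modality {k} v i =
      Σ[ is ∈ Vector (Fin n) (2 + k) ] is zero ≡ i ×
        (∀ (w : Fin (suc k)) →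
           is (inject₁ w) ⊑ is (suc w) ×
           In (is (suc w)) (jointIntervals v w) ×
           Word∈ (segment (is (inject₁ w)) (is (suc w))) (automata v (inject₁ w))) ×
        Word∈ (lastSegment (is (fromℕ (suc k)))) (automata v (fromℕ (suc k)))

    modality-sound : ∀ {k} (v : Vec (Fin N) (suc k)) {i} → Modality v i → Run i (head v)
    modality-sound v (is , refl , h , wd) =
      let x⊑y , iny , seg = h zero
          x≡y , _ = single-sound (yes tt) (path x⊑y) seg
      in subst (λ x → Run x (head v)) (sym x≡y)
           (link-sound v (is ∘ suc) (h ∘ suc , wd) iny)

    module _ (T : Fin n → Fin N) (letter : Fin n → Subset m)
      (isLetter : ∀ x → IsLetter Sat x (letter x))
      (T-loc : ∀ x → Loc (T x) (letter x))
      (T-step : ∀ {x y} → Next x y → Step (T x) (T y))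
      (T-end : End (T end))
      (𝓙 : List Interval)
      (T-clk⊆ : ∀ {x J} → J ∈ clk (T x) → J ∈ 𝓙 × In x J)
      (T-clk⊇ : ∀ {x J} → J ∈ 𝓙 → In x J → J ∈ clk (T x))
      (i : Fin n) where

      open Joints dir hiding (insert)

      Uni : Fin n → Fin n → Set
      Uni = AllUniform (λ J x → In x J) (λ J x → inInterval? (D x) J)
              (λ J x⊑y y⊑z → inInterval-convex J (D-mono x⊑y) (D-mono y⊑z)) i 𝓙

      T-in : ∀ x → All (In x) (clk (T x))
      T-in x = All.tabulate (proj₂ ∘ T-clk⊆)

      T-read : ∀ x → Read (T x) (letter x)
      T-read x = T-loc x , meet-consistent ℝ _ (T-in x)

      letters : ∀ xs → Pointwise (IsLetter Sat) xs (map letter xs)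
      letters []       = []
      letters (x ∷ xs) = isLetter x ∷ letters xs

      -- A claim at `z` is true there, so by uniformity true at both joints; and the types given by
      -- `T` claim every member of `𝓙` that is true.
      T-interior : ∀ {x y z} → i ⊑ x → Uni x y → x ⊑ z → z ⊑ y → ¬ (z ⊑ x) → ¬ (y ⊑ z) →
                   Interior (T x) (T y) (T z)
      T-interior ix u xz zy z⋢x y⋢z =
        All.tabulate (λ J∈ → let J∈𝓙 , inz = T-clk⊆ J∈ in
          T-clk⊇ J∈𝓙 (proj₁ (All.lookup u J∈𝓙 _ (⊑-trans ix xz) xz zy z⋢x y⋢z inz))) ,
        All.tabulate (λ J∈ → let J∈𝓙 , inz = T-clk⊆ J∈ in
          T-clk⊇ J∈𝓙 (proj₂ (All.lookup u J∈𝓙 _ (⊑-trans ix xz) xz zy z⋢x y⋢z inz)))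

      interior-complete : ∀ {x y z ps} → i ⊑ x → Uni x y → x ⊑ z → ¬ (z ≡ y) → Path Next z y (z ∷ ps) →
                          AcceptsFrom (segmentNFA (T x) (T y)) (mid (T z)) (map letter ps)
      interior-complete ix u xz z≢y stop = ⊥-elim (z≢y refl)
      interior-complete {x} {y} ix u xz _ (step d stop) =
        Segment.accepts⁺ (T x) (T y) (T-step d , T-read _) (Segment.final⁺ (T x) (T y))
      interior-complete {x} {y} ix u xz _ (step {y = z′} d p@(step e p′)) =
        Segment.accepts⁺ (T x) (T y)
          (T-step d , T-read z′ ,
           T-interior ix u xz′ (path⇒⊑ p) (λ z′⊑x → next⇒⋢ d (⊑-trans z′⊑x xz)) y⋢z′)
          (interior-complete ix u xz′ (λ { refl → y⋢z′ ⊑-refl }) p)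
        where
        xz′ : x ⊑ z′
        xz′ = ⊑-trans xz (next⇒⊑ d)
        y⋢z′ : ¬ (y ⊑ z′)
        y⋢z′ y⊑z′ = next⇒⋢ e (⊑-trans (path⇒⊑ p′) y⊑z′)

      segment-complete : ∀ {x y ps} → i ⊑ x → Uni x y → Path Next x y ps →
                         Word∈ ps (segmentNFA (T x) (T y))
      segment-complete {x} ix u stop =
        letter x ∷ [] , isLetter x ∷ [] ,
        Segment.accepts⁺ (T x) (T x) (refl , T-read x) (Segment.final⁺ (T x) (T x))
      segment-complete {x} {y} ix u p@(step {ps = ps} d p′) =
        letter x ∷ map letter ps , isLetter x ∷ letters ps ,
        Segment.accepts⁺ (T x) (T y) (refl , T-read x)
          (interior-complete ix u ⊑-refl
            (λ { refl → next⇒⋢ d (path⇒⊑ p′) }) p)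

      single-complete : ∀ {E} (e? : Dec E) {x ps} → E → Path Next x x ps →
                        Word∈ ps (Single.nfa E e? (T x))
      single-complete e? e (step d p) = ⊥-elim (next⇒⋢ d (path⇒⊑ p))
      single-complete {E} e? {x} e stop =
        letter x ∷ [] , isLetter x ∷ [] ,
        Single.accepts⁺ E e? (T x) (e , T-read x) (Single.final⁺ E e? (T x))

      joint-in : ∀ {k} (v : Vec (Fin n) k) w → In (Vec.lookup v w) (jointIntervals (Vec.map T v) w)
      joint-in (x ∷ v) zero    = ∈meet⁺ ℝ _ (T-in x)
      joint-in (x ∷ v) (suc w) = joint-in v w

      segmentStep : ∀ {x y} → i ⊑ x → x ⊑ y → Uni x y →
                    Word∈ (segment x y) (segmentNFA (T x) (T y))
      segmentStep ix x⊑y u = segment-complete ix u (path x⊑y)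

      link-complete : ∀ {x k} → i ⊑ x → (js : Joint x k) → ForSegments Uni js →
                      Link (Vec.map T (vertices js)) (Vec.lookup (vertices js))
      link-complete {x} ix last u = links , single-complete (end? (T end)) T-end (lastPath end)
        where
        links : ∀ w → _
        links zero = ⊑-end x , joint-in (x ∷ end ∷ []) (suc zero) , segmentStep ix (⊑-end x) u
      link-complete {x} ix (step {y = y} x⊑y js) (u , us)
        with link-complete (⊑-trans ix x⊑y) js us
      ... | links , final = links′ , final
        where
        links′ : ∀ w → _
        links′ zero    = x⊑y , joint-in (x ∷ vertices js) (suc zero) , segmentStep ix x⊑y u
        links′ (suc w) = links w

      modality-complete : ∃[ v ] Modality {suc (length 𝓙 * 2)} (T i ∷ v) i
      modality-complete
        with uniformJoints (λ J x → In x J) (λ J x → inInterval? (D x) J)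
               (λ J x⊑y y⊑z → inInterval-convex J (D-mono x⊑y) (D-mono y⊑z)) i 𝓙
      ... | js , us with link-complete ⊑-refl js us
      ...   | links , final =
        Vec.map T (later js) , Vec.lookup (i ∷ vertices js) , refl , links′ , final
        where
        links′ : ∀ w → _
        links′ zero    = ⊑-refl , joint-in (vertices js) zero ,
                         single-complete (yes tt) tt (path ⊑-refl)
        links′ (suc w) = links w

-- Types

-- A guess of which atoms, clock constraints and temporal subformulae hold at
-- a position.
Ty : ∀ {p} → TPTL p → Set
Ty (atom _)  = Bool
Ty (natom _) = Bool
Ty ⊤ᵗ        = ⊤
Ty ⊥ᵗ        = ⊤
Ty (x∙ _)    = ⊤
Ty (clock _) = Bool
Ty (φ ∧ᵗ χ)  = Ty φ × Ty χ
Ty (φ ∨ᵗ χ)  = Ty φ × Ty χ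
Ty (φ 𝖴 χ)   = Bool × Ty φ × Ty χ
Ty (φ 𝖲 χ)   = Bool × Ty φ × Ty χ
Ty (𝓖 φ)     = Bool × Ty φ
Ty (𝓗 φ)     = Bool × Ty φ

-- Boolean combinations are evaluated, not guessed. `x∙ _` counts as false, which makes the freeze
-- case of soundness vacuous.
Holds : ∀ {p} (φ : TPTL p) → Ty φ → Set
Holds (atom _)  b             = T b
Holds (natom _) b             = T b
Holds ⊤ᵗ        _             = ⊤
Holds ⊥ᵗ        _             = ⊥
Holds (x∙ _)    _             = ⊥
Holds (clock _) b             = T b
Holds (φ ∧ᵗ χ)  (t , u)       = Holds φ t × Holds χ u
Holds (φ ∨ᵗ χ)  (t , u)       = Holds φ t ⊎ Holds χ u
Holds (φ 𝖴 χ)   (b , _)       = T b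
Holds (φ 𝖲 χ)   (b , _)       = T b
Holds (𝓖 φ)     (b , _)       = T b
Holds (𝓗 φ)     (b , _)       = T b

holds? : ∀ {p} (φ : TPTL p) t → Dec (Holds φ t)
holds? (atom _)  b       = T? b
holds? (natom _) b       = T? b
holds? ⊤ᵗ        _       = yes tt
holds? ⊥ᵗ        _       = no λ ()
holds? (x∙ _)    _       = no λ ()
holds? (clock _) b       = T? b
holds? (φ ∧ᵗ χ)  (t , u) = holds? φ t ×-dec holds? χ u
holds? (φ ∨ᵗ χ)  (t , u) = holds? φ t ⊎-dec holds? χ u
holds? (φ 𝖴 χ)   (b , _) = T? b
holds? (φ 𝖲 χ)   (b , _) = T? b
holds? (𝓖 φ)     (b , _) = T? b
holds? (𝓗 φ)     (b , _) = T? b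

-- Conditions on the guesses at consecutive positions.  They need only make
-- the guesses sound: formulae are in negation normal form.
Step : ∀ {p} (φ : TPTL p) → Ty φ → Ty φ → Set
Step (atom _)  _           _              = ⊤
Step (natom _) _           _              = ⊤
Step ⊤ᵗ        _           _              = ⊤
Step ⊥ᵗ        _           _              = ⊤
Step (x∙ _)    _           _              = ⊤
Step (clock _) _           _              = ⊤
Step (φ ∧ᵗ χ)  (t , u)     (t′ , u′)      = Step φ t t′ × Step χ u u′
Step (φ ∨ᵗ χ)  (t , u)     (t′ , u′)      = Step φ t t′ × Step χ u u′
Step (φ 𝖴 χ)   (b , t , u) (b′ , t′ , u′) =
  (T b → Holds χ u′ ⊎ Holds φ t′ × T b′) × Step φ t t′ × Step χ u u′
Step (φ 𝖲 χ)   (b , t , u) (b′ , t′ , u′) =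
  (T b′ → Holds χ u ⊎ Holds φ t × T b) × Step φ t t′ × Step χ u u′
Step (𝓖 φ)     (b , t)     (b′ , t′)      = (T b → Holds φ t′ × T b′) × Step φ t t′
Step (𝓗 φ)     (b , t)     (b′ , t′)      = (T b′ → Holds φ t × T b) × Step φ t t′

step? : ∀ {p} (φ : TPTL p) t t′ → Dec (Step φ t t′)
step? (atom _)  _           _              = yes tt
step? (natom _) _           _              = yes tt
step? ⊤ᵗ        _           _              = yes tt
step? ⊥ᵗ        _           _              = yes tt
step? (x∙ _)    _           _              = yes tt
step? (clock _) _           _              = yes tt
step? (φ ∧ᵗ χ)  (t , u)     (t′ , u′)      = step? φ t t′ ×-dec step? χ u u′
step? (φ ∨ᵗ χ)  (t , u)     (t′ , u′)      = step? φ t t′ ×-dec step? χ u u′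
step? (φ 𝖴 χ)   (b , t , u) (b′ , t′ , u′) =
  (T? b →-dec (holds? χ u′ ⊎-dec (holds? φ t′ ×-dec T? b′))) ×-dec step? φ t t′ ×-dec step? χ u u′
step? (φ 𝖲 χ)   (b , t , u) (b′ , t′ , u′) =
  (T? b′ →-dec (holds? χ u ⊎-dec (holds? φ t ×-dec T? b))) ×-dec step? φ t t′ ×-dec step? χ u u′
step? (𝓖 φ)     (b , t)     (b′ , t′)      = (T? b →-dec (holds? φ t′ ×-dec T? b′)) ×-dec step? φ t t′
step? (𝓗 φ)     (b , t)     (b′ , t′)      = (T? b′ →-dec (holds? φ t ×-dec T? b)) ×-dec step? φ t t′

-- At the last position the strict `𝖴` is false, while the strict `𝓖` is vacuously true and may be
-- claimed freely. The past operators are dealt with by `First`.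
Last : ∀ {p} (φ : TPTL p) → Ty φ → Set
Last (atom _)  _           = ⊤
Last (natom _) _           = ⊤
Last ⊤ᵗ        _           = ⊤
Last ⊥ᵗ        _           = ⊤
Last (x∙ _)    _           = ⊤
Last (clock _) _           = ⊤
Last (φ ∧ᵗ χ)  (t , u)     = Last φ t × Last χ u
Last (φ ∨ᵗ χ)  (t , u)     = Last φ t × Last χ u
Last (φ 𝖴 χ)   (b , t , u) = ¬ T b × Last φ t × Last χ u
Last (φ 𝖲 χ)   (b , t , u) = Last φ t × Last χ u
Last (𝓖 φ)     (b , t)     = Last φ t
Last (𝓗 φ)     (b , t)     = Last φ t

last? : ∀ {p} (φ : TPTL p) t → Dec (Last φ t)
last? (atom _)  _           = yes tt
last? (natom _) _           = yes tt
last? ⊤ᵗ        _           = yes tt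
last? ⊥ᵗ        _           = yes tt
last? (x∙ _)    _           = yes tt
last? (clock _) _           = yes tt
last? (φ ∧ᵗ χ)  (t , u)     = last? φ t ×-dec last? χ u
last? (φ ∨ᵗ χ)  (t , u)     = last? φ t ×-dec last? χ u
last? (φ 𝖴 χ)   (b , t , u) = ¬? (T? b) ×-dec last? φ t ×-dec last? χ u
last? (φ 𝖲 χ)   (b , t , u) = last? φ t ×-dec last? χ u
last? (𝓖 φ)     (b , t)     = last? φ t
last? (𝓗 φ)     (b , t)     = last? φ t

First : ∀ {p} (φ : TPTL p) → Ty φ → Set
First (atom _)  _           = ⊤
First (natom _) _           = ⊤
First ⊤ᵗ        _           = ⊤
First ⊥ᵗ        _           = ⊤
First (x∙ _)    _           = ⊤
First (clock _) _           = ⊤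
First (φ ∧ᵗ χ)  (t , u)     = First φ t × First χ u
First (φ ∨ᵗ χ)  (t , u)     = First φ t × First χ u
First (φ 𝖴 χ)   (b , t , u) = First φ t × First χ u
First (φ 𝖲 χ)   (b , t , u) = ¬ T b × First φ t × First χ u
First (𝓖 φ)     (b , t)     = First φ t
First (𝓗 φ)     (b , t)     = First φ t

first? : ∀ {p} (φ : TPTL p) t → Dec (First φ t)
first? (atom _)  _           = yes tt
first? (natom _) _           = yes tt
first? ⊤ᵗ        _           = yes tt
first? ⊥ᵗ        _           = yes tt
first? (x∙ _)    _           = yes tt
first? (clock _) _           = yes tt
first? (φ ∧ᵗ χ)  (t , u)     = first? φ t ×-dec first? χ u
first? (φ ∨ᵗ χ)  (t , u)     = first? φ t ×-dec first? χ u
first? (φ 𝖴 χ)   (b , t , u) = first? φ t ×-dec first? χ u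
first? (φ 𝖲 χ)   (b , t , u) = ¬? (T? b) ×-dec first? φ t ×-dec first? χ u
first? (𝓖 φ)     (b , t)     = first? φ t
first? (𝓗 φ)     (b , t)     = first? φ t

guessed : ∀ {p} (φ : TPTL p) → Ty φ → List Interval
guessed (atom _)  _           = []
guessed (natom _) _           = []
guessed ⊤ᵗ        _           = []
guessed ⊥ᵗ        _           = []
guessed (x∙ _)    _           = []
guessed (clock c) b           = if b then differenceInterval c ∷ [] else []
guessed (φ ∧ᵗ χ)  (t , u)     = guessed φ t ++ guessed χ u
guessed (φ ∨ᵗ χ)  (t , u)     = guessed φ t ++ guessed χ u
guessed (φ 𝖴 χ)   (b , t , u) = guessed φ t ++ guessed χ u
guessed (φ 𝖲 χ)   (b , t , u) = guessed φ t ++ guessed χ u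
guessed (𝓖 φ)     (b , t)     = guessed φ t
guessed (𝓗 φ)     (b , t)     = guessed φ t

types : ∀ {p} (φ : TPTL p) → List (Ty φ)
types (atom _)  = bools
types (natom _) = bools
types ⊤ᵗ        = tt ∷ []
types ⊥ᵗ        = tt ∷ []
types (x∙ _)    = tt ∷ []
types (clock _) = bools
types (φ ∧ᵗ χ)  = cartesianProduct (types φ) (types χ)
types (φ ∨ᵗ χ)  = cartesianProduct (types φ) (types χ)
types (φ 𝖴 χ)   = cartesianProduct bools (cartesianProduct (types φ) (types χ))
types (φ 𝖲 χ)   = cartesianProduct bools (cartesianProduct (types φ) (types χ))
types (𝓖 φ)     = cartesianProduct bools (types φ)
types (𝓗 φ)     = cartesianProduct bools (types φ)

∈-types : ∀ {p} (φ : TPTL p) t → t ∈ types φ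
∈-types (atom _)  b           = ∈-bools b
∈-types (natom _) b           = ∈-bools b
∈-types ⊤ᵗ        _           = here refl
∈-types ⊥ᵗ        _           = here refl
∈-types (x∙ _)    _           = here refl
∈-types (clock _) b           = ∈-bools b
∈-types (φ ∧ᵗ χ)  (t , u)     = ∈-cartesianProduct⁺ (∈-types φ t) (∈-types χ u)
∈-types (φ ∨ᵗ χ)  (t , u)     = ∈-cartesianProduct⁺ (∈-types φ t) (∈-types χ u)
∈-types (φ 𝖴 χ)   (b , t , u) =
  ∈-cartesianProduct⁺ (∈-bools b) (∈-cartesianProduct⁺ (∈-types φ t) (∈-types χ u))
∈-types (φ 𝖲 χ)   (b , t , u) =
  ∈-cartesianProduct⁺ (∈-bools b) (∈-cartesianProduct⁺ (∈-types φ t) (∈-types χ u))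
∈-types (𝓖 φ)     (b , t)     = ∈-cartesianProduct⁺ (∈-bools b) (∈-types φ t)
∈-types (𝓗 φ)     (b , t)     = ∈-cartesianProduct⁺ (∈-bools b) (∈-types φ t)

atoms : ∀ {p} → TPTL p → List (Fin p)
atoms (atom a)  = a ∷ []
atoms (natom a) = a ∷ []
atoms ⊤ᵗ        = []
atoms ⊥ᵗ        = []
atoms (x∙ _)    = []
atoms (clock _) = []
atoms (φ ∧ᵗ χ)  = atoms φ ++ atoms χ
atoms (φ ∨ᵗ χ)  = atoms φ ++ atoms χ
atoms (φ 𝖴 χ)   = atoms φ ++ atoms χ
atoms (φ 𝖲 χ)   = atoms φ ++ atoms χ
atoms (𝓖 φ)     = atoms φ
atoms (𝓗 φ)     = atoms φ

-- The alphabet is indexed by the occurrences of atoms in the formula and not by all `p`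
-- propositions, as the size bound must not depend on `p`. A proposition can occur repeatedly in
-- `L`, hence the quantifier over indices in `Loc`.
module Letters {p} (L : List (Fin p)) where

  Loc : (φ : TPTL p) → Ty φ → Subset (length L) → Set
  Loc (atom a)  b           s = T b → ∀ k → lookup L k ≡ a → k Subset.∈ s
  Loc (natom a) b           s = T b → ∀ k → lookup L k ≡ a → ¬ (k Subset.∈ s)
  Loc ⊤ᵗ        _           s = ⊤
  Loc ⊥ᵗ        _           s = ⊤
  Loc (x∙ _)    _           s = ⊤
  Loc (clock _) _           s = ⊤
  Loc (φ ∧ᵗ χ)  (t , u)     s = Loc φ t s × Loc χ u s
  Loc (φ ∨ᵗ χ)  (t , u)     s = Loc φ t s × Loc χ u s
  Loc (φ 𝖴 χ)   (b , t , u) s = Loc φ t s × Loc χ u s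
  Loc (φ 𝖲 χ)   (b , t , u) s = Loc φ t s × Loc χ u s
  Loc (𝓖 φ)     (b , t)     s = Loc φ t s
  Loc (𝓗 φ)     (b , t)     s = Loc φ t s

  loc? : ∀ φ t s → Dec (Loc φ t s)
  loc? (atom a)  b           s =
    T? b →-dec Finₚ.all? λ k → (lookup L k Fin.≟ a) →-dec (k Subsetₚ.∈? s)
  loc? (natom a) b           s =
    T? b →-dec Finₚ.all? λ k → (lookup L k Fin.≟ a) →-dec ¬? (k Subsetₚ.∈? s)
  loc? ⊤ᵗ        _           s = yes tt
  loc? ⊥ᵗ        _           s = yes tt
  loc? (x∙ _)    _           s = yes tt
  loc? (clock _) _           s = yes tt
  loc? (φ ∧ᵗ χ)  (t , u)     s = loc? φ t s ×-dec loc? χ u s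
  loc? (φ ∨ᵗ χ)  (t , u)     s = loc? φ t s ×-dec loc? χ u s
  loc? (φ 𝖴 χ)   (b , t , u) s = loc? φ t s ×-dec loc? χ u s
  loc? (φ 𝖲 χ)   (b , t , u) s = loc? φ t s ×-dec loc? χ u s
  loc? (𝓖 φ)     (b , t)     s = loc? φ t s
  loc? (𝓗 φ)     (b , t)     s = loc? φ t s

-- From runs of types to truth

⋖-above : ∀ {n} {x y k : Fin n} → x ⋖ y → x Fin.< k → k ≡ y ⊎ y Fin.< k
⋖-above {k = k} e x<k with ℕₚ.m≤n⇒m<n∨m≡n (subst (ℕ._≤ toℕ k) (sym e) x<k)
... | inj₁ y<k = inj₂ y<k
... | inj₂ y≡k = inj₁ (sym (Finₚ.toℕ-injective y≡k))

⋖-below : ∀ {n} {x y k : Fin n} → y ⋖ x → k Fin.< x → k ≡ y ⊎ k Fin.< y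
⋖-below {k = k} e k<x with ℕₚ.m≤n⇒m<n∨m≡n (ℕₚ.≤-pred (subst (suc (toℕ k) ℕ.≤_) e k<x))
... | inj₁ k<y = inj₂ k<y
... | inj₂ k≡y = inj₁ (Finₚ.toℕ-injective k≡y)

⋖⇒< : ∀ {n} {x y : Fin n} → x ⋖ y → x Fin.< y
⋖⇒< e = ℕₚ.≤-reflexive (sym e)

module Semantics {ℝ : RealNumbers} {p : ℕ} (ρ : TimedWord ℝ p) (ν : RealNumbers.Carrier ℝ) where
  open RealNumbers ℝ using (Carrier; _-_)
  open OrderedField ℝ using (neg-difference; inInterval-neg)
  open TimedWord ρ

  infix 4 _⊨_

  _⊨_ : Fin len → TPTL p → Set
  i ⊨ φ = _∣_⊨ᵗ_ ρ i ν φ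

  clock⇔ : ∀ {i} c → i ⊨ clock c ⇔ InInterval ℝ (τ i - ν) (differenceInterval c)
  clock⇔ (T-x∈ I) = mk⇔ id id
  clock⇔ {i} (x-T∈ I) = mk⇔
    (inInterval-neg I (neg-difference (τ i) ν))
    (λ h → subst (InInterval ℝ (ν - τ i)) (neg-involutive I)
             (inInterval-neg (neg I) (neg-difference ν (τ i)) h))

  module Soundness (L : List (Fin p)) {e b : Fin len} (e≡ : toℕ e ≡ pred len) (b≡ : toℕ b ≡ 0) where
    open Letters L

    Sat : Fin (length L) → Fin len → Set
    Sat k j = lookup L k Subset.∈ σ j

    Fits : ∀ φ → Fin len → Ty φ → Set
    Fits φ x t = (∃[ s ] IsLetter Sat x s × Loc φ t s) ×
                 All (InInterval ℝ (τ x - ν)) (guessed φ t)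

    Future Past : ∀ φ → Fin len → Ty φ → Set
    Future φ = Chain (forward e≡) (Fits φ) (Step φ) (Last φ)
    Past φ   = Chain (backward b≡) (Fits φ) (flip (Step φ)) (First φ)

    -- Types are nested tuples, so a run for a formula contains one for each immediate subformula.
    -- The fields are what is required to transport a chain in either direction.
    record Projection (φ χ : TPTL p) : Set where
      field
        proj     : Ty φ → Ty χ
        loc      : ∀ {t s} → Loc φ t s → Loc χ (proj t) s
        guessed⊇ : ∀ x t → All (InInterval ℝ (τ x - ν)) (guessed φ t) →
                   All (InInterval ℝ (τ x - ν)) (guessed χ (proj t))
        next     : ∀ {t t′} → Step φ t t′ → Step χ (proj t) (proj t′)
        last     : ∀ {t} → Last φ t → Last χ (proj t)
        first    : ∀ {t} → First φ t → First χ (proj t)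

      fits : ∀ {x t} → Fits φ x t → Fits χ x (proj t)
      fits {t = t} ((s , l , h) , c) = (s , l , loc h) , guessed⊇ _ t c

      future : ∀ {x t} → Future φ x t → Future χ x (proj t)
      future = chain-map proj fits next last

      past : ∀ {x t} → Past φ x t → Past χ x (proj t)
      past = chain-map proj fits next first

    open Projection using (future; past)

    ∧ˡ : ∀ {φ χ} → Projection (φ ∧ᵗ χ) φ
    ∧ˡ = record { proj = proj₁ ; loc = proj₁ ; guessed⊇ = λ _ _ → Allₚ.++⁻ˡ _
                ; next = proj₁ ; last = proj₁ ; first = proj₁ }

    ∧ʳ : ∀ {φ χ} → Projection (φ ∧ᵗ χ) χ
    ∧ʳ {φ} = record { proj = proj₂ ; loc = proj₂ ; guessed⊇ = λ _ t → Allₚ.++⁻ʳ (guessed φ (proj₁ t))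
                    ; next = proj₂ ; last = proj₂ ; first = proj₂ }

    ∨ˡ : ∀ {φ χ} → Projection (φ ∨ᵗ χ) φ
    ∨ˡ = record { proj = proj₁ ; loc = proj₁ ; guessed⊇ = λ _ _ → Allₚ.++⁻ˡ _
                ; next = proj₁ ; last = proj₁ ; first = proj₁ }

    ∨ʳ : ∀ {φ χ} → Projection (φ ∨ᵗ χ) χ
    ∨ʳ {φ} = record { proj = proj₂ ; loc = proj₂ ; guessed⊇ = λ _ t → Allₚ.++⁻ʳ (guessed φ (proj₁ t))
                    ; next = proj₂ ; last = proj₂ ; first = proj₂ }

    𝖴ˡ : ∀ {φ χ} → Projection (φ 𝖴 χ) φ
    𝖴ˡ = record { proj = proj₁ ∘ proj₂ ; loc = proj₁ ; guessed⊇ = λ _ _ → Allₚ.++⁻ˡ _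
                ; next = proj₁ ∘ proj₂ ; last = proj₁ ∘ proj₂ ; first = proj₁ }

    𝖴ʳ : ∀ {φ χ} → Projection (φ 𝖴 χ) χ
    𝖴ʳ {φ} = record { proj = proj₂ ∘ proj₂ ; loc = proj₂
                    ; guessed⊇ = λ _ t → Allₚ.++⁻ʳ (guessed φ (proj₁ (proj₂ t)))
                    ; next = proj₂ ∘ proj₂ ; last = proj₂ ∘ proj₂ ; first = proj₂ }

    𝖲ˡ : ∀ {φ χ} → Projection (φ 𝖲 χ) φ
    𝖲ˡ = record { proj = proj₁ ∘ proj₂ ; loc = proj₁ ; guessed⊇ = λ _ _ → Allₚ.++⁻ˡ _
                ; next = proj₁ ∘ proj₂ ; last = proj₁ ; first = proj₁ ∘ proj₂ }

    𝖲ʳ : ∀ {φ χ} → Projection (φ 𝖲 χ) χ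
    𝖲ʳ {φ} = record { proj = proj₂ ∘ proj₂ ; loc = proj₂
                    ; guessed⊇ = λ _ t → Allₚ.++⁻ʳ (guessed φ (proj₁ (proj₂ t)))
                    ; next = proj₂ ∘ proj₂ ; last = proj₂ ; first = proj₂ ∘ proj₂ }

    𝓖↓ : ∀ {φ} → Projection (𝓖 φ) φ
    𝓖↓ = record { proj = proj₂ ; loc = id ; guessed⊇ = λ _ _ → id ; next = proj₂ ; last = id ; first = id }

    𝓗↓ : ∀ {φ} → Projection (𝓗 φ) φ
    𝓗↓ = record { proj = proj₂ ; loc = id ; guessed⊇ = λ _ _ → id ; next = proj₂ ; last = id ; first = id }

    -- Subformulae may look both ways, hence two runs that leave `x` with the same type.
    Sound : TPTL p → Set
    Sound φ = ∀ {x t} → Future φ x t → Past φ x t → Holds φ t → x ⊨ φ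

    -- The recursion follows the future chain. Each link left behind is prepended to the past chain,
    -- which thus remains a run from the current position.
    until-sound : ∀ {φ χ} → Sound φ → Sound χ → Sound (φ 𝖴 χ)
    until-sound sφ sχ (stop _ (¬b , _)) _ b = ⊥-elim (¬b b)
    until-sound {φ} {χ} sφ sχ {x} {t} (step {y = y} {r = t′} g d st f) q b
      with proj₁ st b
    ... | inj₁ u = y , ⋖⇒< {x = x} {y} d , sχ (future 𝖴ʳ f) (past 𝖴ʳ q′) u , λ k x<k k<y →
                   ⊥-elim (case-above k x<k k<y)
      where
      q′ : Past (φ 𝖴 χ) y t′
      q′ = step (chain-good f) d st q
      case-above : ∀ k → x Fin.< k → k Fin.< y → ⊥
      case-above k x<k k<y with ⋖-above {x = x} {y} {k} d x<k
      ... | inj₁ refl = ℕₚ.<-irrefl refl k<y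
      ... | inj₂ y<k  = ℕₚ.<-asym y<k k<y
    ... | inj₂ (h , b′) with until-sound sφ sχ f (step (chain-good f) d st q) b′
    ...   | j , y<j , hj , hk = j , ℕₚ.<-trans (⋖⇒< {x = x} {y} d) y<j , hj , hk′
      where
      hk′ : ∀ k → x Fin.< k → k Fin.< j → k ⊨ φ
      hk′ k x<k k<j with ⋖-above {x = x} {y} {k} d x<k
      ... | inj₁ refl = sφ (future 𝖴ˡ f) (past 𝖴ˡ (step (chain-good f) d st q)) h
      ... | inj₂ y<k  = hk k y<k k<j

    since-sound : ∀ {φ χ} → Sound φ → Sound χ → Sound (φ 𝖲 χ)
    since-sound sφ sχ _ (stop _ (¬b , _)) b = ⊥-elim (¬b b)
    since-sound {φ} {χ} sφ sχ {x} {t} q (step {y = y} {r = t′} g d st f) b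
      with proj₁ st b
    ... | inj₁ u = y , ⋖⇒< {x = y} {x} d , sχ (future 𝖲ʳ q′) (past 𝖲ʳ f) u , λ k y<k k<x →
                   ⊥-elim (case-below k y<k k<x)
      where
      q′ : Future (φ 𝖲 χ) y t′
      q′ = step (chain-good f) d st q
      case-below : ∀ k → y Fin.< k → k Fin.< x → ⊥
      case-below k y<k k<x with ⋖-below {x = x} {y} {k} d k<x
      ... | inj₁ refl = ℕₚ.<-irrefl refl y<k
      ... | inj₂ k<y  = ℕₚ.<-asym y<k k<y
    ... | inj₂ (h , b′) with since-sound sφ sχ (step (chain-good f) d st q) f b′
    ...   | j , j<y , hj , hk = j , ℕₚ.<-trans j<y (⋖⇒< {x = y} {x} d) , hj , hk′
      where
      hk′ : ∀ k → j Fin.< k → k Fin.< x → k ⊨ φ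
      hk′ k j<k k<x with ⋖-below {x = x} {y} {k} d k<x
      ... | inj₁ refl = sφ (future 𝖲ˡ (step (chain-good f) d st q)) (past 𝖲ˡ f) h
      ... | inj₂ k<y  = hk k j<k k<y

    always-sound : ∀ {φ} → Sound φ → Sound (𝓖 φ)
    always-sound sφ (stop _ _) _ b j e<j =
      ⊥-elim (ℕₚ.<⇒≱ e<j (Direction.⊑-end (forward e≡) j))
    always-sound sφ {x} (step {y = y} g d st f) q b j x<j
      with proj₁ st b | ⋖-above {x = x} {y} {j} d x<j
    ... | h , b′ | inj₁ refl = sφ (future 𝓖↓ f) (past 𝓖↓ (step (chain-good f) d st q)) h
    ... | h , b′ | inj₂ y<j  = always-sound sφ f (step (chain-good f) d st q) b′ j y<j

    historically-sound : ∀ {φ} → Sound φ → Sound (𝓗 φ)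
    historically-sound sφ _ (stop _ _) b j j<b =
      ⊥-elim (ℕₚ.<⇒≱ j<b (Direction.⊑-end (backward b≡) j))
    historically-sound sφ {x} q (step {y = y} g d st f) b j j<x
      with proj₁ st b | ⋖-below {x = x} {y} {j} d j<x
    ... | h , b′ | inj₁ refl = sφ (future 𝓗↓ (step (chain-good f) d st q)) (past 𝓗↓ f) h
    ... | h , b′ | inj₂ j<y  = historically-sound sφ (step (chain-good f) d st q) f b′ j j<y

    Covered : TPTL p → Set
    Covered φ = ∀ {a} → a ∈ atoms φ → a ∈ L

    sound : ∀ φ → Covered φ → Sound φ
    sound (atom a) cov f _ b with chain-good f | cov (here refl)
    ... | (s , l , h) , _ | a∈L =
      subst (Subset._∈ σ _) (sym (Anyₚ.lookup-index a∈L))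
        (to (l (Any.index a∈L)) (h b (Any.index a∈L) (sym (Anyₚ.lookup-index a∈L))))
    sound (natom a) cov f _ b a∈σ with chain-good f | cov (here refl)
    ... | (s , l , h) , _ | a∈L =
      h b (Any.index a∈L) (sym (Anyₚ.lookup-index a∈L))
        (from (l (Any.index a∈L)) (subst (Subset._∈ σ _) (Anyₚ.lookup-index a∈L) a∈σ))
    sound ⊤ᵗ cov _ _ _ = tt
    sound (clock c) cov {t = true} f _ b with chain-good f
    ... | _ , h ∷ [] = from (clock⇔ c) h
    sound (φ ∧ᵗ χ) cov F P (h , k) =
      sound φ (cov ∘ ∈-++⁺ˡ) (future ∧ˡ F) (past ∧ˡ P) h ,
      sound χ (cov ∘ ∈-++⁺ʳ (atoms φ)) (future ∧ʳ F) (past ∧ʳ P) k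
    sound (φ ∨ᵗ χ) cov F P (inj₁ h) = inj₁ (sound φ (cov ∘ ∈-++⁺ˡ) (future ∨ˡ F) (past ∨ˡ P) h)
    sound (φ ∨ᵗ χ) cov F P (inj₂ k) = inj₂ (sound χ (cov ∘ ∈-++⁺ʳ (atoms φ)) (future ∨ʳ F) (past ∨ʳ P) k)
    sound (φ 𝖴 χ) cov = until-sound (sound φ (cov ∘ ∈-++⁺ˡ)) (sound χ (cov ∘ ∈-++⁺ʳ (atoms φ)))
    sound (φ 𝖲 χ) cov = since-sound (sound φ (cov ∘ ∈-++⁺ˡ)) (sound χ (cov ∘ ∈-++⁺ʳ (atoms φ)))
    sound (𝓖 φ) cov = always-sound (sound φ cov)
    sound (𝓗 φ) cov = historically-sound (sound φ cov)

-- From truth to runs of types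

module Completeness {ℝ : RealNumbers} {p : ℕ} (ρ : TimedWord ℝ p) (ν : RealNumbers.Carrier ℝ) where
  open RealNumbers ℝ using (Carrier; _-_)
  open OrderedField ℝ using (inInterval?)
  open TimedWord ρ
  open Semantics ρ ν

  -- There are finitely many positions and the order of the reals is decidable by trichotomy. Truth
  -- can therefore be recorded in Booleans, and satisfaction is stable under double negation.
  sat? : ∀ i φ → FreezeFree φ → Dec (i ⊨ φ)
  sat? i (atom a)  _ = a Subsetₚ.∈? σ i
  sat? i (natom a) _ = ¬? (a Subsetₚ.∈? σ i)
  sat? i ⊤ᵗ        _ = yes tt
  sat? i ⊥ᵗ        _ = no λ ()
  sat? i (clock (T-x∈ I)) _ = inInterval? (τ i - ν) I
  sat? i (clock (x-T∈ I)) _ = inInterval? (ν - τ i) I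
  sat? i (φ ∧ᵗ χ)  (f , g) = sat? i φ f ×-dec sat? i χ g
  sat? i (φ ∨ᵗ χ)  (f , g) = sat? i φ f ⊎-dec sat? i χ g
  sat? i (φ 𝖴 χ)   (f , g) = Finₚ.any? λ j → (i Fin.<? j) ×-dec sat? j χ g ×-dec
    Finₚ.all? λ k → (i Fin.<? k) →-dec ((k Fin.<? j) →-dec sat? k φ f)
  sat? i (φ 𝖲 χ)   (f , g) = Finₚ.any? λ j → (j Fin.<? i) ×-dec sat? j χ g ×-dec
    Finₚ.all? λ k → (j Fin.<? k) →-dec ((k Fin.<? i) →-dec sat? k φ f)
  sat? i (𝓖 φ)     f = Finₚ.all? λ j → (i Fin.<? j) →-dec sat? j φ f
  sat? i (𝓗 φ)     f = Finₚ.all? λ j → (j Fin.<? i) →-dec sat? j φ f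

  truth : ∀ φ → FreezeFree φ → Fin len → Ty φ
  truth φ@(atom _)  f       i = ⌊ sat? i φ f ⌋
  truth φ@(natom _) f       i = ⌊ sat? i φ f ⌋
  truth ⊤ᵗ          _       i = tt
  truth ⊥ᵗ          _       i = tt
  truth φ@(clock _) f       i = ⌊ sat? i φ f ⌋
  truth (φ ∧ᵗ χ)    (f , g) i = truth φ f i , truth χ g i
  truth (φ ∨ᵗ χ)    (f , g) i = truth φ f i , truth χ g i
  truth ψ@(φ 𝖴 χ)   (f , g) i = ⌊ sat? i ψ (f , g) ⌋ , truth φ f i , truth χ g i
  truth ψ@(φ 𝖲 χ)   (f , g) i = ⌊ sat? i ψ (f , g) ⌋ , truth φ f i , truth χ g i
  truth ψ@(𝓖 φ)     f       i = ⌊ sat? i ψ f ⌋ , truth φ f i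
  truth ψ@(𝓗 φ)     f       i = ⌊ sat? i ψ f ⌋ , truth φ f i

  truth-holds : ∀ φ f {i} → i ⊨ φ → Holds φ (truth φ f i)
  truth-holds φ@(atom _)  f {i} h = fromWitness {a? = sat? i φ f} h
  truth-holds φ@(natom _) f {i} h = fromWitness {a? = sat? i φ f} h
  truth-holds ⊤ᵗ          f h = tt
  truth-holds φ@(clock _) f {i} h = fromWitness {a? = sat? i φ f} h
  truth-holds (φ ∧ᵗ χ)    (f , g) (h , k) = truth-holds φ f h , truth-holds χ g k
  truth-holds (φ ∨ᵗ χ)    (f , g) = Sum.map (truth-holds φ f) (truth-holds χ g)
  truth-holds ψ@(φ 𝖴 χ)   f {i} h = fromWitness {a? = sat? i ψ f} h
  truth-holds ψ@(φ 𝖲 χ)   f {i} h = fromWitness {a? = sat? i ψ f} h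
  truth-holds ψ@(𝓖 φ)     f {i} h = fromWitness {a? = sat? i ψ f} h
  truth-holds ψ@(𝓗 φ)     f {i} h = fromWitness {a? = sat? i ψ f} h

  truth-step : ∀ φ f {x y} → x ⋖ y → Step φ (truth φ f x) (truth φ f y)
  truth-step (atom _)  f d = tt
  truth-step (natom _) f d = tt
  truth-step ⊤ᵗ        f d = tt
  truth-step ⊥ᵗ        f d = tt
  truth-step (clock _) f d = tt
  truth-step (φ ∧ᵗ χ) (f , g) d = truth-step φ f d , truth-step χ g d
  truth-step (φ ∨ᵗ χ) (f , g) d = truth-step φ f d , truth-step χ g d
  truth-step ψ@(φ 𝖴 χ) (f , g) {x} {y} d = unfold , truth-step φ f d , truth-step χ g d
    where
    unfold : T ⌊ sat? x ψ (f , g) ⌋ →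
             Holds χ (truth χ g y) ⊎ Holds φ (truth φ f y) × T ⌊ sat? y ψ (f , g) ⌋
    unfold b with toWitness {a? = sat? x ψ (f , g)} b
    ... | j , x<j , hj , hk with ⋖-above {x = x} {y} {j} d x<j
    ...   | inj₁ refl = inj₁ (truth-holds χ g hj)
    ...   | inj₂ y<j  = inj₂
      ( truth-holds φ f (hk y (⋖⇒< {x = x} {y} d) y<j)
      , fromWitness {a? = sat? y ψ (f , g)}
          (j , y<j , hj , λ k y<k → hk k (ℕₚ.<-trans (⋖⇒< {x = x} {y} d) y<k)))
  truth-step ψ@(φ 𝖲 χ) (f , g) {x} {y} d = unfold , truth-step φ f d , truth-step χ g d
    where
    unfold : T ⌊ sat? y ψ (f , g) ⌋ →
             Holds χ (truth χ g x) ⊎ Holds φ (truth φ f x) × T ⌊ sat? x ψ (f , g) ⌋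
    unfold b with toWitness {a? = sat? y ψ (f , g)} b
    ... | j , j<y , hj , hk with ⋖-below {x = y} {x} {j} d j<y
    ...   | inj₁ refl = inj₁ (truth-holds χ g hj)
    ...   | inj₂ j<x  = inj₂
      ( truth-holds φ f (hk x j<x (⋖⇒< {x = x} {y} d))
      , fromWitness {a? = sat? x ψ (f , g)}
          (j , j<x , hj , λ k j<k k<x → hk k j<k (ℕₚ.<-trans k<x (⋖⇒< {x = x} {y} d))))
  truth-step ψ@(𝓖 φ) f {x} {y} d = unfold , truth-step φ f d
    where
    unfold : T ⌊ sat? x ψ f ⌋ → Holds φ (truth φ f y) × T ⌊ sat? y ψ f ⌋
    unfold b = let h = toWitness {a? = sat? x ψ f} b in
      truth-holds φ f (h y (⋖⇒< {x = x} {y} d)) ,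
      fromWitness {a? = sat? y ψ f} λ j y<j → h j (ℕₚ.<-trans (⋖⇒< {x = x} {y} d) y<j)
  truth-step ψ@(𝓗 φ) f {x} {y} d = unfold , truth-step φ f d
    where
    unfold : T ⌊ sat? y ψ f ⌋ → Holds φ (truth φ f x) × T ⌊ sat? x ψ f ⌋
    unfold b = let h = toWitness {a? = sat? y ψ f} b in
      truth-holds φ f (h x (⋖⇒< {x = x} {y} d)) ,
      fromWitness {a? = sat? x ψ f} λ j j<x → h j (ℕₚ.<-trans j<x (⋖⇒< {x = x} {y} d))

  truth-last : ∀ φ f {e} → (∀ (j : Fin len) → j Fin.≤ e) → Last φ (truth φ f e)
  truth-last (atom _)  f le = tt
  truth-last (natom _) f le = tt
  truth-last ⊤ᵗ        f le = tt
  truth-last ⊥ᵗ        f le = tt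
  truth-last (clock _) f le = tt
  truth-last (φ ∧ᵗ χ) (f , g) le = truth-last φ f le , truth-last χ g le
  truth-last (φ ∨ᵗ χ) (f , g) le = truth-last φ f le , truth-last χ g le
  truth-last ψ@(φ 𝖴 χ) (f , g) {e} le =
    (λ b → let j , e<j , _ = toWitness {a? = sat? e ψ (f , g)} b in ℕₚ.<⇒≱ e<j (le j)) ,
    truth-last φ f le , truth-last χ g le
  truth-last (φ 𝖲 χ) (f , g) le = truth-last φ f le , truth-last χ g le
  truth-last (𝓖 φ) f le = truth-last φ f le
  truth-last (𝓗 φ) f le = truth-last φ f le

  truth-first : ∀ φ f {b} → (∀ (j : Fin len) → b Fin.≤ j) → First φ (truth φ f b)
  truth-first (atom _)  f le = tt
  truth-first (natom _) f le = tt
  truth-first ⊤ᵗ        f le = tt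
  truth-first ⊥ᵗ        f le = tt
  truth-first (clock _) f le = tt
  truth-first (φ ∧ᵗ χ) (f , g) le = truth-first φ f le , truth-first χ g le
  truth-first (φ ∨ᵗ χ) (f , g) le = truth-first φ f le , truth-first χ g le
  truth-first (φ 𝖴 χ) (f , g) le = truth-first φ f le , truth-first χ g le
  truth-first ψ@(φ 𝖲 χ) (f , g) {b} le =
    (λ h → let j , j<b , _ = toWitness {a? = sat? b ψ (f , g)} h in ℕₚ.<⇒≱ j<b (le j)) ,
    truth-first φ f le , truth-first χ g le
  truth-first (𝓖 φ) f le = truth-first φ f le
  truth-first (𝓗 φ) f le = truth-first φ f le

  truth-guessed⁻ : ∀ φ f {x} → All (InInterval ℝ (τ x - ν)) (guessed φ (truth φ f x))
  truth-guessed⁻ (atom _)  f = []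
  truth-guessed⁻ (natom _) f = []
  truth-guessed⁻ ⊤ᵗ        f = []
  truth-guessed⁻ ⊥ᵗ        f = []
  truth-guessed⁻ (clock c) f {x} with sat? x (clock c) f
  ... | yes h = to (clock⇔ c) h ∷ []
  ... | no _  = []
  truth-guessed⁻ (φ ∧ᵗ χ) (f , g) = Allₚ.++⁺ (truth-guessed⁻ φ f) (truth-guessed⁻ χ g)
  truth-guessed⁻ (φ ∨ᵗ χ) (f , g) = Allₚ.++⁺ (truth-guessed⁻ φ f) (truth-guessed⁻ χ g)
  truth-guessed⁻ (φ 𝖴 χ)  (f , g) = Allₚ.++⁺ (truth-guessed⁻ φ f) (truth-guessed⁻ χ g)
  truth-guessed⁻ (φ 𝖲 χ)  (f , g) = Allₚ.++⁺ (truth-guessed⁻ φ f) (truth-guessed⁻ χ g)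
  truth-guessed⁻ (𝓖 φ)    f       = truth-guessed⁻ φ f
  truth-guessed⁻ (𝓗 φ)    f       = truth-guessed⁻ φ f

  Recorded : ∀ φ → FreezeFree φ → Fin len → ClockConstraint → Set
  Recorded φ f x c = InInterval ℝ (τ x - ν) (differenceInterval c) →
                     differenceInterval c ∈ guessed φ (truth φ f x)

  -- Maximality of the recorded claims: a joint must claim whatever an interior position of an
  -- adjoining segment claims.
  truth-guessed⁺ : ∀ φ f {x} → All (Recorded φ f x) (freeConstraints φ)
  truth-guessed⁺-++ : ∀ φ χ f g {x} →
    All (λ c → InInterval ℝ (τ x - ν) (differenceInterval c) →
               differenceInterval c ∈ guessed φ (truth φ f x) ++ guessed χ (truth χ g x))
        (freeConstraints φ ++ freeConstraints χ)
  truth-guessed⁺-++ φ χ f g {x} = Allₚ.++⁺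
    (All.map (λ h → ∈-++⁺ˡ ∘ h) (truth-guessed⁺ φ f))
    (All.map (λ h → ∈-++⁺ʳ (guessed φ (truth φ f x)) ∘ h) (truth-guessed⁺ χ g))
  truth-guessed⁺ (atom _)  f = []
  truth-guessed⁺ (natom _) f = []
  truth-guessed⁺ ⊤ᵗ        f = []
  truth-guessed⁺ ⊥ᵗ        f = []
  truth-guessed⁺ (clock c) f {x} with sat? x (clock c) f
  ... | yes _ = (λ _ → here refl) ∷ []
  ... | no ¬h = (λ h → ⊥-elim (¬h (from (clock⇔ c) h))) ∷ []
  truth-guessed⁺ (φ ∧ᵗ χ) (f , g) = truth-guessed⁺-++ φ χ f g
  truth-guessed⁺ (φ ∨ᵗ χ) (f , g) = truth-guessed⁺-++ φ χ f g
  truth-guessed⁺ (φ 𝖴 χ)  (f , g) = truth-guessed⁺-++ φ χ f g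
  truth-guessed⁺ (φ 𝖲 χ)  (f , g) = truth-guessed⁺-++ φ χ f g
  truth-guessed⁺ (𝓖 φ)    f       = truth-guessed⁺ φ f
  truth-guessed⁺ (𝓗 φ)    f       = truth-guessed⁺ φ f

  module _ (L : List (Fin p)) where
    open Letters L

    reads : Fin len → Fin (length L) → Bool
    reads x k = ⌊ lookup L k Subsetₚ.∈? σ x ⌋

    letter : Fin len → Subset (length L)
    letter x = Vec.tabulate (reads x)

    letter-correct : ∀ x → IsLetter (λ k j → lookup L k Subset.∈ σ j) x (letter x)
    letter-correct x k = mk⇔
      (λ k∈ → toWitness {a? = a?}
                (from T-≡ (trans (sym (Vecₚ.lookup∘tabulate (reads x) k)) (Vecₚ.[]=⇒lookup k∈))))
      (λ h → Vecₚ.lookup⇒[]= k (letter x)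
               (trans (Vecₚ.lookup∘tabulate (reads x) k) (to T-≡ (fromWitness {a? = a?} h))))
      where
      a? : Dec (lookup L k Subset.∈ σ x)
      a? = lookup L k Subsetₚ.∈? σ x

    truth-loc : ∀ φ f {x} → Loc φ (truth φ f x) (letter x)
    truth-loc φ@(atom a) f {x} b k refl =
      from (letter-correct x k) (toWitness {a? = sat? x φ f} b)
    truth-loc φ@(natom a) f {x} b k refl k∈ =
      toWitness {a? = sat? x φ f} b (to (letter-correct x k) k∈)
    truth-loc ⊤ᵗ        f = tt
    truth-loc ⊥ᵗ        f = tt
    truth-loc (clock _) f = tt
    truth-loc (φ ∧ᵗ χ) (f , g) = truth-loc φ f , truth-loc χ g
    truth-loc (φ ∨ᵗ χ) (f , g) = truth-loc φ f , truth-loc χ g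
    truth-loc (φ 𝖴 χ)  (f , g) = truth-loc φ f , truth-loc χ g
    truth-loc (φ 𝖲 χ)  (f , g) = truth-loc φ f , truth-loc χ g
    truth-loc (𝓖 φ)    f       = truth-loc φ f
    truth-loc (𝓗 φ)    f       = truth-loc φ f

-- The translation

rejecting : NFA 0
rejecting = record { states = 1 ; initial = zero ; final = Subset.⊥ ; transitions = [] }

-- `PnEMTL` has no constants, and with `p` equal to 0 it has no atoms either; falsity is therefore a
-- modality whose automata accept nothing.
⊥ᵖ : ∀ {p} → PnEMTL p
⊥ᵖ = 𝓕 1 (λ _ → full) (λ _ → rejecting) (λ ())

⋁ : ∀ {p} → List (PnEMTL p) → PnEMTL p
⋁ []       = ⊥ᵖ
⋁ (φ ∷ φs) = ¬ᵖ (¬ᵖ φ ∧ᵖ ¬ᵖ ⋁ φs)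

rejecting-rejects : ∀ w → ¬ Accepts rejecting w
rejecting-rejects []      ()
rejecting-rejects (_ ∷ _) (_ , () , _)

module _ {ℝ : RealNumbers} {p : ℕ} (ρ : TimedWord ℝ p) {i : Fin (TimedWord.len ρ)} where

  ⋁⁺ : ∀ {φs} → Any (_⊨ᵖ_ ρ i) φs → _⊨ᵖ_ ρ i (⋁ φs)
  ⋁⁺ (here h)   (¬h , _) = ¬h h
  ⋁⁺ (there hs) (_ , ¬h) = ¬h (⋁⁺ hs)

  -- Only up to ¬ ¬, as ⊨ᵖ has not been shown decidable.
  ⋁⁻ : ∀ φs → _⊨ᵖ_ ρ i (⋁ φs) → ¬ ¬ Any (_⊨ᵖ_ ρ i) φs
  ⋁⁻ []       (_ , _ , _ , w , _ , acc) _ = rejecting-rejects w acc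
  ⋁⁻ (φ ∷ φs) h ¬any = h (¬any ∘ here , λ h′ → ⋁⁻ φs h′ (¬any ∘ there))

guessed⊆ : ∀ {p} (φ : TPTL p) t {J} → J ∈ guessed φ t → J ∈ map differenceInterval (freeConstraints φ)
guessed⊆-++ : ∀ {p} (φ χ : TPTL p) t u {J} → J ∈ guessed φ t ++ guessed χ u →
              J ∈ map differenceInterval (freeConstraints φ ++ freeConstraints χ)
guessed⊆-++ φ χ t u {J} J∈ = subst (J ∈_) (sym (map-++ differenceInterval (freeConstraints φ) _))
  ([ ∈-++⁺ˡ ∘ guessed⊆ φ t , ∈-++⁺ʳ _ ∘ guessed⊆ χ u ]′ (∈-++⁻ (guessed φ t) J∈))
guessed⊆ (clock c) true  J∈          = J∈
guessed⊆ (φ ∧ᵗ χ)  (t , u)           = guessed⊆-++ φ χ t u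
guessed⊆ (φ ∨ᵗ χ)  (t , u)           = guessed⊆-++ φ χ t u
guessed⊆ (φ 𝖴 χ)   (_ , t , u)       = guessed⊆-++ φ χ t u
guessed⊆ (φ 𝖲 χ)   (_ , t , u)       = guessed⊆-++ φ χ t u
guessed⊆ (𝓖 φ)     (_ , t)           = guessed⊆ φ t
guessed⊆ (𝓗 φ)     (_ , t)           = guessed⊆ φ t

-- K is the number of distinct difference intervals; each needs joints at its
-- first and its last position.
module Translation {p} (φ : TPTL p) (K : ℕ) where

  L : List (Fin p)
  L = atoms φ

  open Letters L

  N m k : ℕ
  N = length (types φ)
  m = length L
  -- Counts the joints beyond the one at the current position: two per interval, and the end of the
  -- word.
  k = suc (K * 2)

  decode : Fin N → Ty φ
  decode = lookup (types φ)

  encode : Ty φ → Fin N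
  encode t = Any.index (∈-types φ t)

  decode-encode : ∀ t → decode (encode t) ≡ t
  decode-encode t = sym (Anyₚ.lookup-index (∈-types φ t))

  module After = Segments {N} {m}
    (Loc φ ∘ decode) (loc? φ ∘ decode)
    (λ q r → Step φ (decode q) (decode r)) (λ q r → step? φ (decode q) (decode r))
    (Last φ ∘ decode) (last? φ ∘ decode)
    (guessed φ ∘ decode)

  -- `𝓟` measures `τ i - τ x` and reads from right to left, so the intervals are negated, the steps
  -- reversed, and the boundary condition is that of the first position.
  module Before = Segments {N} {m}
    (Loc φ ∘ decode) (loc? φ ∘ decode)
    (λ q r → Step φ (decode r) (decode q)) (λ q r → step? φ (decode r) (decode q))
    (First φ ∘ decode) (first? φ ∘ decode)
    (map neg ∘ guessed φ ∘ decode)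

  letters : Vector (PnEMTL p) m
  letters = atom ∘ lookup L

  after before : Vec (Fin N) (suc k) → PnEMTL p
  after  v = 𝓕 (suc k) (After.jointIntervals v) (After.automata v) letters
  before v = 𝓟 (suc k) (Before.jointIntervals v) (Before.automata v) letters

  -- A common type at the current position ties the two modalities together; the types at the other
  -- joints are chosen separately on each side.
  Guess : Set
  Guess = Fin N × Vec (Fin N) k × Vec (Fin N) k

  disjunct : Guess → PnEMTL p
  disjunct (q , v , w) = after (q ∷ v) ∧ᵖ before (q ∷ w)

  accepted? : ∀ (g : Guess) → Dec (Holds φ (decode (proj₁ g)))
  accepted? (q , _) = holds? φ (decode q)

  all-vectors : List (Vec (Fin N) k)
  all-vectors = vectors (allFin N) k

  all-guesses guesses : List Guess
  all-guesses = cartesianProduct (allFin N) (cartesianProduct all-vectors all-vectors)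
  guesses = filter accepted? all-guesses

  ∈-guesses : ∀ {q v w} → Holds φ (decode q) → (q , v , w) ∈ guesses
  ∈-guesses {q} {v} {w} = ∈-filter⁺ accepted?
    (∈-cartesianProduct⁺ (∈-allFin q)
      (∈-cartesianProduct⁺ (∈-vectors ∈-allFin v) (∈-vectors ∈-allFin w)))

  translation : PnEMTL p
  translation = ⋁ (map disjunct guesses)

  module _ {ℝ : RealNumbers} (ρ : TimedWord ℝ p) (i : Fin (TimedWord.len ρ)) where
    open RealNumbers ℝ using (_-_) renaming (_≤_ to _≤ᴿ_)
    open OrderedField ℝ
      using (≤-respˡ-≈; ≤-respʳ-≈; ≈-sym; neg-difference; neg-antimono-≤; -‿monoˡ-≤; inInterval-neg)
    open TimedWord ρ
    open Semantics ρ (τ i)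

    Sat : Fin m → Fin len → Set
    Sat t j = lookup L t Subset.∈ σ j

    e≡ = proj₂ (lastPosition i)
    b≡ = proj₂ (firstPosition i)

    past-mono : ∀ {x y : Fin len} → y Fin.≤ x → (τ i - τ x) ≤ᴿ (τ i - τ y)
    past-mono {x} {y} y≤x =
      ≤-respˡ-≈ (≈-sym (neg-difference (τ i) (τ x)))
        (≤-respʳ-≈ (≈-sym (neg-difference (τ i) (τ y)))
          (neg-antimono-≤ (-‿monoˡ-≤ (τ i) (τ-mono y≤x))))

    -- With these instances `Modality` coincides by unfolding with the semantics of `after`, and
    -- with that of `before` in the next one.
    module Future = After.Line (forward e≡) ℝ (λ x → τ x - τ i) (λ x≤y → -‿monoˡ-≤ (τ i) (τ-mono x≤y)) Sat
    module Past = Before.Line (backward b≡) ℝ (λ x → τ i - τ x) (λ {x} {y} → past-mono {x} {y}) Sat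

    open Soundness L e≡ b≡ using (sound) renaming (Future to FutureRun; Past to PastRun)

    in-neg⁺ : ∀ {x J} → InInterval ℝ (τ x - τ i) J → InInterval ℝ (τ i - τ x) (neg J)
    in-neg⁺ {x} {J} = inInterval-neg J (neg-difference (τ i) (τ x))

    in-neg⁻ : ∀ {x J} → InInterval ℝ (τ i - τ x) (neg J) → InInterval ℝ (τ x - τ i) J
    in-neg⁻ {x} {J} h = subst (InInterval ℝ (τ x - τ i)) (neg-involutive J)
      (inInterval-neg (neg J) (neg-difference (τ x) (τ i)) h)

    future-run : ∀ {q} → Future.Run i q → FutureRun φ i (decode q)
    future-run = chain-map decode id id id

    past-run : ∀ {q} → Past.Run i q → PastRun φ i (decode q)
    past-run = chain-map decode (λ {x} (l , c) → l , All.map (λ {J} → in-neg⁻ {x} {J}) (Allₚ.map⁻ c)) id id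

    disjunct-sound : ∀ g → Holds φ (decode (proj₁ g)) → _⊨ᵖ_ ρ i (disjunct g) → i ⊨ φ
    disjunct-sound (q , v , w) h (f , b) = sound φ id
      (future-run (Future.modality-sound (q ∷ v) f)) (past-run (Past.modality-sound (q ∷ w) b)) h

    module _ (ff : FreezeFree φ) where
      open Completeness ρ (τ i)

      -- The disjunct obtained from `⋁⁻` is available only under a double negation, but the goal is
      -- decidable and hence stable.
      translation-sound : _⊨ᵖ_ ρ i translation → i ⊨ φ
      translation-sound h = decidable-stable (sat? i φ ff) λ ¬sat →
        ⋁⁻ ρ (map disjunct guesses) h λ any →
          let g , g∈ , hg = find (Anyₚ.map⁻ any)
          in ¬sat (disjunct-sound g (proj₂ (∈-filter⁻ accepted? {xs = all-guesses} g∈)) hg)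

      module _ (𝓙 : List Interval) (K≡ : length 𝓙 ≡ K)
        (𝓙⊆ : ∀ {J} → J ∈ 𝓙 → J ∈ map differenceInterval (freeConstraints φ))
        (𝓙⊇ : ∀ {J} → J ∈ map differenceInterval (freeConstraints φ) → J ∈ 𝓙) where

        type : Fin len → Fin N
        type x = encode (truth φ ff x)

        decode-type : ∀ x → decode (type x) ≡ truth φ ff x
        decode-type x = decode-encode (truth φ ff x)

        type-loc : ∀ x → Loc φ (decode (type x)) (letter L x)
        type-loc x rewrite decode-type x = truth-loc L φ ff

        type-step : ∀ {x y} → x ⋖ y → Step φ (decode (type x)) (decode (type y))
        type-step {x} {y} d rewrite decode-type x | decode-type y = truth-step φ ff d

        type-last : Last φ (decode (type (proj₁ (lastPosition i))))
        type-last rewrite decode-type (proj₁ (lastPosition i)) =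
          truth-last φ ff (Direction.⊑-end (forward e≡))

        type-first : First φ (decode (type (proj₁ (firstPosition i))))
        type-first rewrite decode-type (proj₁ (firstPosition i)) =
          truth-first φ ff (Direction.⊑-end (backward b≡))

        type-guessed⁻ : ∀ {x J} → J ∈ guessed φ (decode (type x)) → J ∈ 𝓙 × InInterval ℝ (τ x - τ i) J
        type-guessed⁻ {x} {J} J∈ =
          𝓙⊇ (guessed⊆ φ _ J∈) ,
          All.lookup (truth-guessed⁻ φ ff) (subst (λ t → J ∈ guessed φ t) (decode-type x) J∈)

        type-guessed⁺ : ∀ {x J} → J ∈ 𝓙 → InInterval ℝ (τ x - τ i) J → J ∈ guessed φ (decode (type x))
        type-guessed⁺ {x} J∈ h with ∈-map⁻ differenceInterval (𝓙⊆ J∈)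
        ... | c , c∈ , refl =
          subst (λ t → differenceInterval c ∈ guessed φ t) (sym (decode-type x))
            (All.lookup (truth-guessed⁺ φ ff) c∈ h)

        future-complete : ∃[ v ] _⊨ᵖ_ ρ i (after (type i ∷ v))
        future-complete = subst (λ K′ → ∃[ v ] Future.Modality {suc (K′ * 2)} (type i ∷ v) i) K≡
          (Future.modality-complete type (letter L) (letter-correct L) type-loc
            (λ {x} {y} → type-step {x} {y}) type-last 𝓙
            type-guessed⁻ type-guessed⁺ i)

        past-complete : ∃[ v ] _⊨ᵖ_ ρ i (before (type i ∷ v))
        past-complete = subst (λ K′ → ∃[ v ] Past.Modality {suc (K′ * 2)} (type i ∷ v) i)
          (trans (length-map neg 𝓙) K≡)
          (Past.modality-complete type (letter L) (letter-correct L) type-loc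
            (λ {x} {y} → type-step {y} {x}) type-first (map neg 𝓙)
            guessed⁻ guessed⁺ i)
          where
          guessed⁻ : ∀ {x J} → J ∈ map neg (guessed φ (decode (type x))) →
                     J ∈ map neg 𝓙 × InInterval ℝ (τ i - τ x) J
          guessed⁻ {x} J∈ with ∈-map⁻ neg J∈
          ... | J , J∈′ , refl = let h , c = type-guessed⁻ {x} J∈′ in ∈-map⁺ neg h , in-neg⁺ {x} {J} c
          guessed⁺ : ∀ {x J} → J ∈ map neg 𝓙 → InInterval ℝ (τ i - τ x) J →
                     J ∈ map neg (guessed φ (decode (type x)))
          guessed⁺ {x} J∈ h with ∈-map⁻ neg J∈
          ... | J , J∈′ , refl = ∈-map⁺ neg (type-guessed⁺ {x} J∈′ (in-neg⁻ {x} {J} h))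

        translation-complete : i ⊨ φ → _⊨ᵖ_ ρ i translation
        translation-complete h =
          let v , f = future-complete
              w , b = past-complete
          in ⋁⁺ ρ (Anyₚ.map⁺ (lose (∈-guesses (subst (Holds φ) (sym (decode-type i)) (truth-holds φ ff h)))
                                    (f , b)))

-- Size, arity and non-adjacency

-- Every binary operator counts 1, so the leaves of a syntax tree outnumber its size by at most one.
leaves : ∀ {m n s t} → m ≤ suc s → n ≤ suc t → m + n ≤ suc (suc (s + t))
leaves {s = s} {t} p q = ≤-trans (+-mono-≤ p q) (≤-reflexive (cong suc (+-suc s t)))

length-atoms : ∀ {p} (φ : TPTL p) → length (atoms φ) ≤ suc (sizeᵗ φ)
length-atoms (atom _)  = ≤-refl
length-atoms (natom _) = s≤s z≤n
length-atoms ⊤ᵗ        = z≤n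
length-atoms ⊥ᵗ        = z≤n
length-atoms (x∙ φ)    = z≤n
length-atoms (clock _) = z≤n
length-atoms (φ ∧ᵗ χ) rewrite length-++ (atoms φ) {atoms χ} = leaves (length-atoms φ) (length-atoms χ)
length-atoms (φ ∨ᵗ χ) rewrite length-++ (atoms φ) {atoms χ} = leaves (length-atoms φ) (length-atoms χ)
length-atoms (φ 𝖴 χ)  rewrite length-++ (atoms φ) {atoms χ} = leaves (length-atoms φ) (length-atoms χ)
length-atoms (φ 𝖲 χ)  rewrite length-++ (atoms φ) {atoms χ} = leaves (length-atoms φ) (length-atoms χ)
length-atoms (𝓖 φ)     = m≤n⇒m≤1+n (length-atoms φ)
length-atoms (𝓗 φ)     = m≤n⇒m≤1+n (length-atoms φ)

length-freeConstraints : ∀ {p} (φ : TPTL p) → length (freeConstraints φ) ≤ suc (sizeᵗ φ)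
length-freeConstraints (atom _)  = z≤n
length-freeConstraints (natom _) = z≤n
length-freeConstraints ⊤ᵗ        = z≤n
length-freeConstraints ⊥ᵗ        = z≤n
length-freeConstraints (x∙ φ)    = z≤n
length-freeConstraints (clock _) = ≤-refl
length-freeConstraints (φ ∧ᵗ χ) rewrite length-++ (freeConstraints φ) {freeConstraints χ} =
  leaves (length-freeConstraints φ) (length-freeConstraints χ)
length-freeConstraints (φ ∨ᵗ χ) rewrite length-++ (freeConstraints φ) {freeConstraints χ} =
  leaves (length-freeConstraints φ) (length-freeConstraints χ)
length-freeConstraints (φ 𝖴 χ) rewrite length-++ (freeConstraints φ) {freeConstraints χ} =
  leaves (length-freeConstraints φ) (length-freeConstraints χ)
length-freeConstraints (φ 𝖲 χ) rewrite length-++ (freeConstraints φ) {freeConstraints χ} =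
  leaves (length-freeConstraints φ) (length-freeConstraints χ)
length-freeConstraints (𝓖 φ)     = m≤n⇒m≤1+n (length-freeConstraints φ)
length-freeConstraints (𝓗 φ)     = m≤n⇒m≤1+n (length-freeConstraints φ)

-- One bit for each leaf, of which there are at most `1 + sizeᵗ φ`, and one for each temporal
-- operator, of which there are at most `sizeᵗ φ`.
length-types : ∀ {p} (φ : TPTL p) → length (types φ) ≤ exp₂ (suc (2 * sizeᵗ φ))
length-types-× : ∀ {p} (φ χ : TPTL p) →
                 length (cartesianProduct (types φ) (types χ)) ≤ exp₂ (2 * suc (sizeᵗ φ + sizeᵗ χ))
length-types-× φ χ = ≤-trans (length-product-exp₂ (types φ) (types χ) (length-types φ) (length-types χ))
  (≤-reflexive (cong exp₂ (e (sizeᵗ φ) (sizeᵗ χ))))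
  where
  e : ∀ s t → suc (2 * s) + suc (2 * t) ≡ 2 * suc (s + t)
  e = solve-∀
length-types-1 : ∀ {p} (φ : TPTL p) → length (cartesianProduct bools (types φ)) ≤ exp₂ (suc (2 * suc (sizeᵗ φ)))
length-types-1 φ =
  ≤-trans (length-product-exp₂ bools (types φ) {1} 2≤exp₂1 (length-types φ)) (exp₂-mono (e (sizeᵗ φ)))
  where
  e : ∀ s → 1 + suc (2 * s) ≤ suc (2 * suc s)
  e s = s≤s (≤-trans (n≤1+n _) (≤-reflexive (sym (*-suc 2 s))))
length-types (atom _)  = 2≤exp₂1
length-types (natom _) = ≤-trans 2≤exp₂1 (exp₂-mono (s≤s z≤n))
length-types ⊤ᵗ        = 1≤exp₂ 1
length-types ⊥ᵗ        = 1≤exp₂ 1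
length-types (x∙ φ)    = 1≤exp₂ (suc (2 * suc (sizeᵗ φ)))
length-types (clock _) = 2≤exp₂1
length-types (φ ∧ᵗ χ)  = ≤-trans (length-types-× φ χ) (exp₂-mono (n≤1+n _))
length-types (φ ∨ᵗ χ)  = ≤-trans (length-types-× φ χ) (exp₂-mono (n≤1+n _))
length-types (φ 𝖴 χ)   =
  length-product-exp₂ bools (cartesianProduct (types φ) (types χ)) {1} 2≤exp₂1 (length-types-× φ χ)
length-types (φ 𝖲 χ)   =
  length-product-exp₂ bools (cartesianProduct (types φ) (types χ)) {1} 2≤exp₂1 (length-types-× φ χ)
length-types (𝓖 φ)     = length-types-1 φ
length-types (𝓗 φ)     = length-types-1 φ

-- The 2 is the size of `⊥ᵖ`, two automata of one state each. Every disjunct adds three negations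
-- and a conjunction.
⋁-size : ∀ {p} {φs : List (PnEMTL p)} {B} → All (λ φ → sizeᵖ φ ≤ B) φs → sizeᵖ (⋁ φs) ≤ 2 + length φs * (4 + B)
⋁-size []                                = ≤-refl
⋁-size {φs = φ ∷ φs} {B} (h ∷ hs) = begin
  1 + (1 + (1 + sizeᵖ φ) + (1 + sizeᵖ (⋁ φs)))     ≡⟨ e (sizeᵖ φ) (sizeᵖ (⋁ φs)) ⟩
  (4 + sizeᵖ φ) + sizeᵖ (⋁ φs)                     ≤⟨ +-mono-≤ (+-monoʳ-≤ 4 h) (⋁-size hs) ⟩
  (4 + B) + (2 + length φs * (4 + B))              ≡⟨ e′ (4 + B) (length φs * (4 + B)) ⟩
  2 + ((4 + B) + length φs * (4 + B))              ∎
  where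
  e : ∀ a b → 1 + (1 + (1 + a) + (1 + b)) ≡ (4 + a) + b
  e = solve-∀
  e′ : ∀ a b → a + (2 + b) ≡ 2 + (a + b)
  e′ = solve-∀

⋁-arity : ∀ {p} {φs : List (PnEMTL p)} {B} → 1 ≤ B → All (λ φ → arity φ ≤ B) φs → arity (⋁ φs) ≤ B
⋁-arity 1≤B []       = 1≤B
⋁-arity 1≤B (h ∷ hs) = ⊔-lub h (⋁-arity 1≤B hs)

full-nonAdjacent : NonAdjacent full full
full-nonAdjacent ()

⋁-nonAdjacent : ∀ {p} {φs : List (PnEMTL p)} → All NonAdjacentᵖ φs → NonAdjacentᵖ (⋁ φs)
⋁-nonAdjacent []       = (λ _ _ → full-nonAdjacent) , λ ()
⋁-nonAdjacent (h ∷ hs) = h , ⋁-nonAdjacent hs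

module Bounds {p} (φ : TPTL p) (K : ℕ) (K≤ : K ≤ suc (sizeᵗ φ)) where
  open Translation φ K

  -- This is `sizeᵗ (x∙ φ)`, the size in which the final bound is expressed.
  e : ℕ
  e = suc (sizeᵗ φ)

  N≤ : N ≤ exp₂ (2 * e)
  N≤ = ≤-trans (length-types φ) (exp₂-mono (≤-trans (n≤1+n _) (≤-reflexive (sym (*-suc 2 (sizeᵗ φ))))))

  m≤ : m ≤ e
  m≤ = length-atoms φ

  k≤ : k ≤ 1 + 2 * e
  k≤ = s≤s (≤-trans (≤-reflexive (*-comm K 2)) (*-monoʳ-≤ 2 K≤))

  -- At most `3 + 2 * e` automata of size `exp₂ (5 + 5 * e)` give the exponent `8 + 7 * e`; the
  -- atoms in the formula set are absorbed by one more doubling.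
  modality-size : ∀ {f : Vector ℕ (2 + k)} → (∀ w → f w ≤ exp₂ (5 + 5 * e)) →
                  sum {m} (λ _ → 1) + sum f ≤ exp₂ (9 + 7 * e)
  modality-size {f} h = +-exp₂ {a = 8 + 7 * e}
    (begin
      sum {m} (λ _ → 1)     ≤⟨ sum-≤ {m} (λ _ → 1) (λ _ → ≤-refl) ⟩
      m * 1                 ≡⟨ *-identityʳ m ⟩
      m                     ≤⟨ m≤ ⟩
      e                     ≤⟨ n≤exp₂n e ⟩
      exp₂ e                 ≤⟨ exp₂-mono (≤-trans (m≤n*m e 7) (m≤n+m (7 * e) 8)) ⟩
      exp₂ (8 + 7 * e)       ∎)
    (begin
      sum f                              ≤⟨ sum-≤ f h ⟩
      (2 + k) * exp₂ (5 + 5 * e)          ≤⟨ *-exp₂ (≤-trans (+-monoʳ-≤ 2 k≤) (n≤exp₂n (3 + 2 * e))) ≤-refl ⟩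
      exp₂ (3 + 2 * e + (5 + 5 * e))      ≡⟨ cong exp₂ (eq e) ⟩
      exp₂ (8 + 7 * e)                    ∎)
    where
    eq : ∀ e → 3 + 2 * e + (5 + 5 * e) ≡ 8 + 7 * e
    eq = solve-∀

  disjunct-size : ∀ g → sizeᵖ (disjunct g) ≤ exp₂ (11 + 7 * e)
  disjunct-size (q , v , w) = +-exp₂ {a = 10 + 7 * e}
    (+-exp₂ {a = 9 + 7 * e} (1≤exp₂ (9 + 7 * e)) (modality-size (After.automata-size N≤ m≤ (q ∷ v))))
    (≤-trans (modality-size (Before.automata-size N≤ m≤ (q ∷ w))) (exp₂-mono (n≤1+n _)))

  -- Source of the quadratic exponent: `N` is exponential in `e`, and it is raised to the power `k`,
  -- itself linear in `e`, once for each direction.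
  all-guesses-length : length all-guesses ≤ exp₂ (2 * e + (2 * e * (1 + 2 * e) + 2 * e * (1 + 2 * e)))
  all-guesses-length = length-product-exp₂ (allFin N) (cartesianProduct all-vectors all-vectors)
    (≤-trans (≤-reflexive (length-allFin N)) N≤)
    (length-product-exp₂ all-vectors all-vectors vectors≤ vectors≤)
    where
    vectors≤ : length all-vectors ≤ exp₂ (2 * e * (1 + 2 * e))
    vectors≤ = begin
      length all-vectors           ≡⟨ length-vectors (allFin N) k ⟩
      length (allFin N) ^ k        ≡⟨ cong (_^ k) (length-allFin N) ⟩
      N ^ k                        ≤⟨ ^-exp₂ k N≤ ⟩
      exp₂ (2 * e * k)              ≤⟨ exp₂-mono (*-monoʳ-≤ (2 * e) k≤) ⟩
      exp₂ (2 * e * (1 + 2 * e))    ∎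

  translation-size : sizeᵖ translation ≤ 1 * 2 ^ evalPoly sizePoly e
  translation-size = begin
    sizeᵖ translation
      ≤⟨ ⋁-size (Allₚ.map⁺ (All.universal disjunct-size guesses)) ⟩
    2 + length (map disjunct guesses) * (4 + exp₂ (11 + 7 * e))
      ≤⟨ +-exp₂ {a = 12 + 13 * e + 8 * (e * e)} (≤-trans 2≤exp₂1 (exp₂-mono (s≤s z≤n))) (begin
        length (map disjunct guesses) * (4 + exp₂ (11 + 7 * e))
          ≤⟨ *-exp₂ (≤-trans (≤-reflexive (length-map disjunct guesses))
                     (≤-trans (length-filter accepted? all-guesses) all-guesses-length))
                  (+-exp₂ {a = 11 + 7 * e} 4≤ ≤-refl) ⟩
        exp₂ (2 * e + (2 * e * (1 + 2 * e) + 2 * e * (1 + 2 * e)) + suc (11 + 7 * e))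
          ≡⟨ cong exp₂ (eq e) ⟩
        exp₂ (12 + 13 * e + 8 * (e * e)) ∎) ⟩
    exp₂ (13 + 13 * e + 8 * (e * e))
      ≡⟨ cong exp₂ (evalPoly-sizePoly e) ⟨
    exp₂ (evalPoly sizePoly e)
      ≡⟨ exp₂-def (evalPoly sizePoly e) ⟩
    2 ^ evalPoly sizePoly e
      ≡⟨ *-identityˡ _ ⟨
    1 * 2 ^ evalPoly sizePoly e ∎
    where
    4≤ : 4 ≤ exp₂ (11 + 7 * e)
    4≤ = ≤-trans (+-exp₂ {2} {2} 2≤exp₂1 2≤exp₂1) (exp₂-mono (s≤s (s≤s z≤n)))
    eq : ∀ e → 2 * e + (2 * e * (1 + 2 * e) + 2 * e * (1 + 2 * e)) + suc (11 + 7 * e) ≡ 12 + 13 * e + 8 * (e * e)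
    eq = solve-∀

  translation-arity : arity translation ≤ suc k
  translation-arity = ⋁-arity (s≤s z≤n) (Allₚ.map⁺ (All.universal
    (λ _ → ⊔-lub modality-arity modality-arity) guesses))
    where
    modality-arity : suc k ⊔ maximum {m} (λ _ → 0) ≤ suc k
    modality-arity = ⊔-lub ≤-refl (maximum-≤ {m} (λ _ → 0) (λ _ → z≤n))

  -- Whatever types are chosen, the bounds of all joint intervals come from the constraints of the
  -- one formula `φ`, or from their negatives on the past side.
  translation-nonAdjacent : NonAdjacentSet (map differenceInterval (freeConstraints φ)) →
                            NonAdjacentᵖ translation
  translation-nonAdjacent na = ⋁-nonAdjacent (Allₚ.map⁺ (All.universal disjunct-nonAdjacent guesses))
    where
    originates : ∀ {Js Ks} → (∀ {J} → J ∈ Js → J ∈ Ks) → OriginatesIn Ks (meet Js)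
    originates {Js} Js⊆ with meet-originates Js
    ... | l , u = Sum.map₂ (λ (J , J∈ , e) → J , Js⊆ J∈ , e) l ,
                  Sum.map₂ (λ (J , J∈ , e) → J , Js⊆ J∈ , e) u
    after-originates : ∀ q → OriginatesIn (map differenceInterval (freeConstraints φ))
                                          (meet (guessed φ (decode q)))
    after-originates q = originates (guessed⊆ φ (decode q))
    before-originates : ∀ q → OriginatesIn (map neg (map differenceInterval (freeConstraints φ)))
                                           (meet (map neg (guessed φ (decode q))))
    before-originates q = originates λ J∈ → case-neg (∈-map⁻ neg J∈)
      where
      case-neg : ∀ {J} → ∃[ I ] I ∈ guessed φ (decode q) × J ≡ neg I →
                 J ∈ map neg (map differenceInterval (freeConstraints φ))
      case-neg (I , I∈ , refl) = ∈-map⁺ neg (guessed⊆ φ (decode q) I∈)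
    disjunct-nonAdjacent : ∀ g → NonAdjacentᵖ (disjunct g)
    disjunct-nonAdjacent (q , v , w) =
      ((λ a b → nonAdjacent-originates (After.jointIntervals (q ∷ v) a) (After.jointIntervals (q ∷ v) b) na
                  (after-originates (Vec.lookup (q ∷ v) a)) (after-originates (Vec.lookup (q ∷ v) b))) ,
       _) ,
      ((λ a b → nonAdjacent-originates (Before.jointIntervals (q ∷ w) a) (Before.jointIntervals (q ∷ w) b)
                  (nonAdjacentSet-neg na)
                  (before-originates (Vec.lookup (q ∷ w) a)) (before-originates (Vec.lookup (q ∷ w) b))) ,
       _)

-- The first bound is needed for the size of the translation and the second
-- for its arity.
thin : (xs ys : List Interval) → All (_∈ ys) xs →
       ∃[ zs ] (∀ {z} → z ∈ zs → z ∈ xs) × (∀ {x} → x ∈ xs → x ∈ zs) ×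
               length zs ≤ length xs × length zs ≤ length ys
thin xs ys xs⊆ys with ≤-total (length xs) (length ys)
... | inj₁ le = xs , id , id , ≤-refl , le
... | inj₂ le = filter (_∈ᴵ? xs) ys ,
  (λ z∈ → proj₂ (∈-filter⁻ (_∈ᴵ? xs) {xs = ys} z∈)) ,
  (λ x∈ → ∈-filter⁺ (_∈ᴵ? xs) (All.lookup xs⊆ys x∈) x∈) ,
  ≤-trans (length-filter (_∈ᴵ? xs) ys) le ,
  length-filter (_∈ᴵ? xs) ys

-- Each interval may be used with either sign, so the difference intervals lie in a list of twice
-- the length of `𝓘`.
differenceInterval-∈ : ∀ {𝓘} c → interval c ∈ 𝓘 → differenceInterval c ∈ 𝓘 ++ map neg 𝓘
differenceInterval-∈ (T-x∈ I) I∈ = ∈-++⁺ˡ I∈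
differenceInterval-∈ {𝓘} (x-T∈ I) I∈ = ∈-++⁺ʳ 𝓘 (∈-map⁺ neg I∈)

theorem4 : ∃[ C ] ∃[ P ] ∃[ D ]
    ∀ {p : ℕ} (𝓘 : List Interval) → Unique 𝓘 →
    (ψ : TPTL p) → Simple ψ → NonAdjacentᵗ ψ → UsesIntervals 𝓘 ψ →
    ∃[ φ ]
    NonAdjacentᵖ φ ×
    (∀ (ℝ : RealNumbers) (ρ : TimedWord ℝ p) (i : Fin (TimedWord.len ρ)) (ν : RealNumbers.Carrier ℝ) →
    (_∣_⊨ᵗ_ ρ i ν ψ) ⇔ (_⊨ᵖ_ ρ i φ)) ×
    sizeᵖ φ ≤ C * 2 ^ evalPoly P (sizeᵗ ψ) ×
    arity φ ≤ D * (length 𝓘 ^ 2 ⊔ 1)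
theorem4 = 1 , sizePoly , 6 , construct
  where
  -- The arity is linear, at most `2 + 4 * n` for `n` intervals. Both 1 and `n` are bounded by
  -- `n ^ 2 ⊔ 1`, whence the constant 6.
  arity-bound : ∀ n {K} → K ≤ n + n → 2 + K * 2 ≤ 6 * (n ^ 2 ⊔ 1)
  arity-bound n {K} K≤ = begin
    2 + K * 2                                 ≤⟨ +-monoʳ-≤ 2 (*-monoˡ-≤ 2 K≤) ⟩
    2 + (n + n) * 2                           ≡⟨ cong (2 +_) (eq n) ⟩
    2 * 1 + 4 * n                             ≤⟨ +-mono-≤ (*-monoʳ-≤ 2 (m≤n⊔m (n ^ 2) 1))
                                                   (*-monoʳ-≤ 4 (≤-trans (n≤n^2 n) (m≤m⊔n (n ^ 2) 1))) ⟩
    2 * (n ^ 2 ⊔ 1) + 4 * (n ^ 2 ⊔ 1)         ≡⟨ *-distribʳ-+ (n ^ 2 ⊔ 1) 2 4 ⟨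
    6 * (n ^ 2 ⊔ 1)                           ∎
    where
    eq : ∀ n → (n + n) * 2 ≡ 4 * n
    eq = solve-∀
    n≤n^2 : ∀ n → n ≤ n ^ 2
    n≤n^2 zero    = z≤n
    n≤n^2 (suc n) = m≤m*n (suc n) (suc n ^ 1)

  construct : ∀ {p : ℕ} (𝓘 : List Interval) → Unique 𝓘 →
    (ψ : TPTL p) → Simple ψ → NonAdjacentᵗ ψ → UsesIntervals 𝓘 ψ →
    ∃[ χ ]
    NonAdjacentᵖ χ ×
    (∀ (ℝ : RealNumbers) (ρ : TimedWord ℝ p) (i : Fin (TimedWord.len ρ)) (ν : RealNumbers.Carrier ℝ) →
    (_∣_⊨ᵗ_ ρ i ν ψ) ⇔ (_⊨ᵖ_ ρ i χ)) ×
    sizeᵖ χ ≤ 1 * 2 ^ evalPoly sizePoly (sizeᵗ ψ) ×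
    arity χ ≤ 6 * (length 𝓘 ^ 2 ⊔ 1)
  -- The first scope is `x∙ φ` itself, which has no free constraints; the second is the body `φ`.
  construct 𝓘 _ (x∙ φ) (simple ff) (_ ∷ na ∷ _) (_ ∷ uses ∷ _)
    with thin (map differenceInterval (freeConstraints φ)) (𝓘 ++ map neg 𝓘)
              (Allₚ.map⁺ (All.map (λ {c} → differenceInterval-∈ c) uses))
  ... | 𝓙 , 𝓙⊆ , 𝓙⊇ , short , few =
    Translation.translation φ (length 𝓙) , translation-nonAdjacent na ,
    -- The semantics of `x∙ φ` resets the clock to `τ i`, so one equivalence at that value serves
    -- every `ν`.
    (λ ℝ ρ i ν → mk⇔
      (Translation.translation-complete φ (length 𝓙) ρ i ff 𝓙 refl 𝓙⊆ 𝓙⊇)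
      (Translation.translation-sound φ (length 𝓙) ρ i ff)) ,
    translation-size ,
    ≤-trans translation-arity (arity-bound (length 𝓘)
      (≤-trans few (≤-reflexive (trans (length-++ 𝓘) (cong (length 𝓘 +_) (length-map neg 𝓘))))))
    where
    open Bounds φ (length 𝓙)
      (≤-trans short (≤-trans (≤-reflexive (length-map differenceInterval (freeConstraints φ)))
                              (length-freeConstraints φ)))
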